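{- For every $m\geq 0$, $$\sum_{\lambda\in\mathcal P^+}\binom{\kappa(\lambda)}{m}q^{|\lambda|}=\frac{q^{2m^2}-q^{2(m+1)^2}}{(q;q)_\infty}.$$ Equivalently, for every $n,m\geq 0$, $$\sum_{\substack{\lambda\vdash n\\ \lambda\in\mathcal P^+}}\binom{\kappa(\lambda)}{m}=p(n-2m^2)-p\bigl(n-2(m+1)^2\bigr),$$ where $p(N)$ is the number of partitions of $N$ and $p(N)=0$ for $N<0$.
   Context: Let $\lambda$ be a partition with conjugate $\lambda'$ and Durfee size $d$ (the side of the largest square contained in the Young diagram of $\lambda$). Put $\alpha_i=\lambda_i-d$, $\beta_i=\lambda_i'-d$, $I_i=\min(\alpha_i,\beta_i)$ and $U_i=\max(\alpha_i,\beta_i)$ for $1\le i\le d$. The diagonal blocks of $\lambda$ are the edge-connected components of the skew diagram $U/I$ (cells adjacent when they share an edge), and $\kappa(\lambda)$ is their number. The successive ranks of $\lambda$ are $\sigma_i(\lambda)=\lambda_i-\lambda_i'$, $1\le i\le d$. $\mathcal P^+$ is the set of all partitions whose successive ranks are all nonnegative (including the empty partition). Also $(q;q)_\infty=\prod_{j\ge1}(1-q^j)$. -}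

module Defs where

open import Data.Bool using (if_then_else_)
open import Data.Integer as ℤ using (ℤ; +_; -[1+_]; 0ℤ; 1ℤ)
import Data.Integer.Properties as ℤ
open import Data.List
  using (List; []; _∷_; _++_; map; concat; concatMap; filter; foldr; length;
         upTo; applyUpTo; zipWith)
import Data.List.Properties as List
open import Data.List.Extrema.Nat using (max)
open import Data.List.Membership.Propositional using (_∈_; find; lose)
open import Data.List.Membership.Propositional.Properties
  using (∈-concatMap⁺; ∈-concatMap⁻; ∈-concat⁻′; ∈-concat⁺′; ∈-filter⁺; ∈-filter⁻)
open import Data.List.Relation.Binary.Permutation.Propositional
  using (_↭_; prep; ↭-refl; ↭-sym; ↭-trans; ↭-reflexive)
open import Data.List.Relation.Binary.Permutation.Propositional.Properties
  using (++⁺ˡ; shifts)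
open import Data.List.Relation.Unary.All as All using (All; []; _∷_)
import Data.List.Relation.Unary.All.Properties as All
open import Data.List.Relation.Unary.AllPairs as AllPairs using (AllPairs; []; _∷_)
import Data.List.Relation.Unary.AllPairs.Properties as AllPairs
open import Data.List.Relation.Unary.Any as Any using (Any; here; there; any?)
open import Data.List.Relation.Unary.Linked using (Linked; linked?)
open import Data.List.Relation.Unary.Unique.Propositional using (Unique)
import Data.List.Relation.Unary.Unique.Propositional.Properties as Unique
open import Data.Nat
open import Data.Nat.ListAction using (sum)
open import Data.Nat.Combinatorics using (_C_)
open import Data.Nat.Properties
open import Data.Product using (_×_; _,_; proj₁; proj₂)
open import Data.Sum using (_⊎_; inj₁; inj₂)
open import Function using (_∘_)
open import Relation.Binary.Construct.Closure.ReflexiveTransitive as Star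
  using (Star; ε; _◅_; _◅◅_)
open import Relation.Binary.PropositionalEquality
open import Relation.Nullary using (¬_; Dec; yes; no; ¬?)
open import Relation.Nullary.Decidable using (_×-dec_; _⊎-dec_)
open import Relation.Unary using (Decidable)

------------------------------------------------------------------------
-- Partitions

record _⊢_ (π : List ℕ) (n : ℕ) : Set where
  constructor partition
  field
    positive   : All (0 <_) π
    decreasing : Linked _≥_ π
    size       : sum π ≡ n

-- Every composition of n + 1 arises from exactly one composition of n, by
-- putting a new part 1 in front or by increasing the first part.
grow : List ℕ → List (List ℕ)
grow []       = (1 ∷ []) ∷ []
grow (x ∷ xs) = (1 ∷ x ∷ xs) ∷ (suc x ∷ xs) ∷ []

compositions : ℕ → List (List ℕ)
compositions zero    = [] ∷ []
compositions (suc n) = concatMap grow (compositions n)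

-- Each π with π ⊢ n exactly once; see ∈-partitions⁺, ∈-partitions⁻ and
-- partitions-unique below.
partitions : ℕ → List (List ℕ)
partitions n = filter (linked? _≥?_) (compositions n)

p : ℤ → ℕ
p (+ n)    = length (partitions n)
p -[1+ _ ] = 0

------------------------------------------------------------------------
-- Young diagrams.  Rows and columns are numbered from 0, so row π i is the
-- part λ_{i+1}, and the condition 1 ≤ i ≤ d becomes i < d.

Cell : Set
Cell = ℕ × ℕ

row : List ℕ → ℕ → ℕ
row []      _       = 0
row (x ∷ _) zero    = x
row (_ ∷ π) (suc i) = row π i

conjugate : List ℕ → List ℕ
conjugate π = applyUpTo (λ j → length (filter (j <?_) π)) (row π 0)

_∈ʸ_ : Cell → List ℕ → Set
(i , j) ∈ʸ π = j < row π i

-- The k × k square with a corner at the origin.  Any square in a Young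
-- diagram can be moved there, so only these matter for the Durfee size.
SquareIn : List ℕ → ℕ → Set
SquareIn π k = ∀ {i} → i < k → ∀ {j} → j < k → (i , j) ∈ʸ π

squareIn? : ∀ π → Decidable (SquareIn π)
squareIn? π k = allUpTo? (λ i → allUpTo? (λ j → j <? row π i) k) k

durfee : List ℕ → ℕ
durfee π = max 0 (filter (squareIn? π) (upTo (suc (length π))))

-- Truncated subtraction is exact here for i < durfee π.
α β I U : List ℕ → ℕ → ℕ
α π i = row π i ∸ durfee π
β π i = row (conjugate π) i ∸ durfee π
I π i = α π i ⊓ β π i
U π i = α π i ⊔ β π i

skewCells : List ℕ → List Cell
skewCells π =
  concatMap (λ i → map (i ,_) (filter (I π i ≤?_) (upTo (U π i)))) (upTo (durfee π))

σ : List ℕ → ℕ → ℤ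
σ π i = + row π i ℤ.- + row (conjugate π) i

P⁺ : List ℕ → Set
P⁺ π = ∀ {i} → i < durfee π → 0ℤ ℤ.≤ σ π i

P⁺? : Decidable P⁺
P⁺? π = allUpTo? (λ i → 0ℤ ℤ.≤? σ π i) (durfee π)

------------------------------------------------------------------------
-- Edge-connected components

Adjacent : Cell → Cell → Set
Adjacent (i , j) (i′ , j′) =
  (i ≡ i′ × ∣ j - j′ ∣ ≡ 1) ⊎ (j ≡ j′ × ∣ i - i′ ∣ ≡ 1)

adjacent? : ∀ c c′ → Dec (Adjacent c c′)
adjacent? (i , j) (i′ , j′) =
  ((i ≟ i′) ×-dec (∣ j - j′ ∣ ≟ 1)) ⊎-dec ((j ≟ j′) ×-dec (∣ i - i′ ∣ ≟ 1))

Touches : Cell → List Cell → Set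
Touches c b = Any (Adjacent c) b

touches? : ∀ c → Decidable (Touches c)
touches? c = any? (adjacent? c)

-- A new cell merges all the components it touches; see components-correct.
components : List Cell → List (List Cell)
components []       = []
components (c ∷ cs) =
  (c ∷ concat (filter (touches? c) (components cs)))
  ∷ filter (¬? ∘ touches? c) (components cs)

diagonalBlocks : List ℕ → List (List Cell)
diagonalBlocks π = components (skewCells π)

κ : List ℕ → ℕ
κ π = length (diagonalBlocks π)

-- The sum of binom(κ(λ), m) over the λ ⊢ n in P⁺.
blockSum : ℕ → ℕ → ℕ
blockSum m n = sum (map (λ π → κ π C m) (filter P⁺? (partitions n)))

------------------------------------------------------------------------
-- Formal power series in q over ℤ, as coefficient sequences

Series : Set
Series = ℕ → ℤ

infix  4 _≈_
infixl 6 _⊖_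
infixl 7 _⊛_
infix  8 q^_

_≈_ : Series → Series → Set
A ≈ B = ∀ n → A n ≡ B n

∑ : List ℤ → ℤ
∑ = foldr ℤ._+_ 0ℤ

q^_ : ℕ → Series
(q^ k) n = if n ≡ᵇ k then 1ℤ else 0ℤ

_⊖_ : Series → Series → Series
(A ⊖ B) n = A n ℤ.- B n

_⊛_ : Series → Series → Series
(A ⊛ B) n = ∑ (applyUpTo (λ k → A k ℤ.* B (n ∸ k)) (suc n))

-- recips B n lists the coefficients n, n - 1, …, 0 of the reciprocal of a
-- series B with constant term 1 (the only case used), computed from
-- R₀ = 1 and Rₙ₊₁ = - ∑_{k ≤ n} Bₖ₊₁ Rₙ₋ₖ; see recip-correct.
recips : Series → ℕ → List ℤ
recip  : Series → Series

recips B zero    = 1ℤ ∷ []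
recips B (suc n) = recip B (suc n) ∷ recips B n

recip B zero    = 1ℤ
recip B (suc n) =
  ℤ.- ∑ (zipWith ℤ._*_ (applyUpTo (B ∘ suc) (suc n)) (recips B n))

-- (q;q)_N
pochhammer : ℕ → Series
pochhammer zero    = q^ 0
pochhammer (suc N) = pochhammer N ⊛ (q^ 0 ⊖ q^ (suc N))

-- (q;q)_∞: the coefficient of qⁿ is the same in every (q;q)_N with N ≥ n;
-- see pochhammer-stable.
pochhammer∞ : Series
pochhammer∞ n = pochhammer n n

-- ∑_{λ ∈ P⁺} binom(κ(λ), m) q^{|λ|}
blockSeries : ℕ → Series
blockSeries m n = + blockSum m n

------------------------------------------------------------------------
-- partitions n enumerates the partitions of n without repetition

private
  Positive : List ℕ → Set
  Positive = All (0 <_)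

  ∈-grow⁻ : ∀ {n xs ys} → Positive xs → sum xs ≡ n → ys ∈ grow xs →
            Positive ys × sum ys ≡ suc n
  ∈-grow⁻ {xs = []}     _          refl (here refl)         = s≤s z≤n ∷ [] , refl
  ∈-grow⁻ {xs = x ∷ xs} ps         refl (here refl)         = s≤s z≤n ∷ ps , refl
  ∈-grow⁻ {xs = x ∷ xs} (px ∷ ps)  refl (there (here refl)) = s≤s z≤n ∷ ps , refl

  ∈-compositions⁻ : ∀ n {xs} → xs ∈ compositions n → Positive xs × sum xs ≡ n
  ∈-compositions⁻ zero    (here refl) = [] , refl
  ∈-compositions⁻ (suc n) xs∈ with find (∈-concatMap⁻ grow {xs = compositions n} xs∈)
  ... | ys , ys∈ , xs∈grow =
    let pos , eq = ∈-compositions⁻ n ys∈ in ∈-grow⁻ pos eq xs∈grow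

  ∈-compositions⁺ : ∀ n {xs} → Positive xs → sum xs ≡ n → xs ∈ compositions n
  ∈-compositions⁺ zero    {[]}               _        _  = here refl
  ∈-compositions⁺ zero    {suc _ ∷ _}        _        ()
  ∈-compositions⁺ zero    {zero ∷ _}         (() ∷ _) _
  ∈-compositions⁺ (suc n) {zero ∷ xs}        (() ∷ _) _
  ∈-compositions⁺ (suc n) {suc zero ∷ xs}    (_ ∷ ps) eq =
    ∈-concatMap⁺ grow (lose (∈-compositions⁺ n ps (suc-injective eq)) (one∈ xs))
    where
    one∈ : ∀ ys → (1 ∷ ys) ∈ grow ys
    one∈ []      = here refl
    one∈ (_ ∷ _) = here refl
  ∈-compositions⁺ (suc n) {suc (suc x) ∷ xs} (_ ∷ ps) eq =
    ∈-concatMap⁺ grow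
      (lose (∈-compositions⁺ n {suc x ∷ xs} (s≤s z≤n ∷ ps) (suc-injective eq))
            (there (here refl)))

  shrink : List ℕ → List ℕ
  shrink (suc zero ∷ xs)    = xs
  shrink (suc (suc x) ∷ xs) = suc x ∷ xs
  shrink xs                 = xs

  shrink-grow : ∀ {xs ys} → Positive xs → ys ∈ grow xs → shrink ys ≡ xs
  shrink-grow {[]}         _        (here refl)         = refl
  shrink-grow {x ∷ xs}     _        (here refl)         = refl
  shrink-grow {suc x ∷ xs} _        (there (here refl)) = refl
  shrink-grow {zero ∷ xs}  (() ∷ _) _

  grow-unique : ∀ {xs} → Positive xs → Unique (grow xs)
  grow-unique {[]}         _        = [] ∷ []
  grow-unique {suc x ∷ xs} _        = ((λ ()) ∷ []) ∷ [] ∷ []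
  grow-unique {zero ∷ xs}  (() ∷ _)

  concatMap-grow-unique : ∀ {xss} → All Positive xss → Unique xss →
                          Unique (concatMap grow xss)
  concatMap-grow-unique [] [] = []
  concatMap-grow-unique {xs ∷ xss} (ps ∷ pss) (xs∉ ∷ u) =
    Unique.++⁺ (grow-unique ps) (concatMap-grow-unique pss u) disjoint
    where
    disjoint : ∀ {v} → ¬ (v ∈ grow xs × v ∈ concatMap grow xss)
    disjoint (v∈₁ , v∈₂) with find (∈-concatMap⁻ grow {xs = xss} v∈₂)
    ... | ys , ys∈ , v∈ys =
      All.lookup xs∉ ys∈
        (trans (sym (shrink-grow ps v∈₁)) (shrink-grow (All.lookup pss ys∈) v∈ys))

  compositions-unique : ∀ n → Unique (compositions n)
  compositions-unique zero    = [] ∷ []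
  compositions-unique (suc n) =
    concatMap-grow-unique (All.tabulate (proj₁ ∘ ∈-compositions⁻ n))
                          (compositions-unique n)

∈-partitions⁺ : ∀ {π n} → π ⊢ n → π ∈ partitions n
∈-partitions⁺ {n = n} (partition pos dec eq) =
  ∈-filter⁺ (linked? _≥?_) (∈-compositions⁺ n pos eq) dec

∈-partitions⁻ : ∀ {π n} → π ∈ partitions n → π ⊢ n
∈-partitions⁻ {n = n} π∈ with ∈-filter⁻ (linked? _≥?_) {xs = compositions n} π∈
... | π∈c , dec = let pos , eq = ∈-compositions⁻ n π∈c in partition pos dec eq

partitions-unique : ∀ n → Unique (partitions n)
partitions-unique n = Unique.filter⁺ (linked? _≥?_) (compositions-unique n)

------------------------------------------------------------------------
-- components computes the connected components

StepIn : List Cell → Cell → Cell → Set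
StepIn b c c′ = c ∈ b × c′ ∈ b × Adjacent c c′

Connected : List Cell → Set
Connected b = ∀ {x y} → x ∈ b → y ∈ b → Star (StepIn b) x y

Separated : List Cell → List Cell → Set
Separated b b′ = ∀ {x y} → x ∈ b → y ∈ b′ → ¬ Adjacent x y

record AreComponents (cs : List Cell) (bs : List (List Cell)) : Set where
  field
    covers    : concat bs ↭ cs
    nonempty  : All (_≢ []) bs
    connected : All Connected bs
    separated : AllPairs Separated bs

private
  adjacent-sym : ∀ {c c′} → Adjacent c c′ → Adjacent c′ c
  adjacent-sym {i , j} {i′ , j′} (inj₁ (eq , d)) =
    inj₁ (sym eq , trans (∣-∣-comm j′ j) d)
  adjacent-sym {i , j} {i′ , j′} (inj₂ (eq , d)) =
    inj₂ (sym eq , trans (∣-∣-comm i′ i) d)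

  concat-filter-↭ : ∀ {P : List Cell → Set} (P? : Decidable P) bs →
    concat (filter P? bs) ++ concat (filter (¬? ∘ P?) bs) ↭ concat bs
  concat-filter-↭ P? []       = ↭-refl
  concat-filter-↭ P? (b ∷ bs) with P? b
  ... | yes _ =
    ↭-trans (↭-reflexive (List.++-assoc b _ _)) (++⁺ˡ b (concat-filter-↭ P? bs))
  ... | no  _ =
    ↭-trans (shifts (concat (filter P? bs)) b) (++⁺ˡ b (concat-filter-↭ P? bs))

  split-separated : ∀ {P : List Cell → Set} (P? : Decidable P) {bs} →
    AllPairs Separated bs →
    All (λ t → All (Separated t) (filter (¬? ∘ P?) bs)) (filter P? bs)
  split-separated P? [] = []
  split-separated P? {b ∷ bs} (s ∷ ss) with P? b
  ... | yes _ = All.filter⁺ (¬? ∘ P?) s ∷ split-separated P? ss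
  ... | no  _ =
    All.zipWith (λ (sep , rest) →
                   (λ x∈ y∈ → sep y∈ x∈ ∘ adjacent-sym) ∷ rest)
                (All.filter⁺ P? s , split-separated P? ss)

  widen : ∀ {b b′} → (∀ {x} → x ∈ b → x ∈ b′) →
          ∀ {x y} → Star (StepIn b) x y → Star (StepIn b′) x y
  widen inc = Star.map (λ (x∈ , y∈ , adj) → inc x∈ , inc y∈ , adj)

components-correct : ∀ cs → AreComponents cs (components cs)
components-correct [] = record
  { covers = ↭-refl ; nonempty = [] ; connected = [] ; separated = [] }
components-correct (c ∷ cs) = record
  { covers    = prep c (↭-trans (concat-filter-↭ (touches? c) bs) covers)
  ; nonempty  = (λ ()) ∷ All.filter⁺ (¬? ∘ touches? c) nonempty
  ; connected = merged-connected ∷ All.filter⁺ (¬? ∘ touches? c) connected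
  ; separated = All.tabulate merged-separated
                ∷ AllPairs.filter⁺ (¬? ∘ touches? c) separated
  }
  where
  open AreComponents (components-correct cs)
  bs ts us : List (List Cell)
  bs = components cs
  ts = filter (touches? c) bs
  us = filter (¬? ∘ touches? c) bs
  merged : List Cell
  merged = c ∷ concat ts

  toFrom : ∀ {x} → x ∈ merged → Star (StepIn merged) x c × Star (StepIn merged) c x
  toFrom (here refl) = ε , ε
  toFrom (there x∈) with ∈-concat⁻′ ts x∈
  ... | b , x∈b , b∈ts with ∈-filter⁻ (touches? c) {xs = bs} b∈ts
  ... | b∈bs , touch with find touch
  ... | u , u∈b , adj =
    widen inc (conn x∈b u∈b) ◅◅ ((inc u∈b , here refl , adjacent-sym adj) ◅ ε) ,
    ((here refl , inc u∈b , adj) ◅ widen inc (conn u∈b x∈b))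
    where
    conn : Connected b
    conn = All.lookup connected b∈bs
    inc : ∀ {x} → x ∈ b → x ∈ merged
    inc y∈ = there (∈-concat⁺′ y∈ b∈ts)

  merged-connected : Connected merged
  merged-connected x∈ y∈ = proj₁ (toFrom x∈) ◅◅ proj₂ (toFrom y∈)

  merged-separated : ∀ {b} → b ∈ us → Separated merged b
  merged-separated b∈us (here refl) y∈ adj =
    proj₂ (∈-filter⁻ (¬? ∘ touches? c) {xs = bs} b∈us) (lose y∈ adj)
  merged-separated b∈us (there x∈) y∈ adj with ∈-concat⁻′ ts x∈
  ... | t , x∈t , t∈ts =
    All.lookup (All.lookup (split-separated (touches? c) separated) t∈ts) b∈us x∈t y∈ adj

------------------------------------------------------------------------
-- Power series: reciprocals and the infinite product

private
  applyUpTo-cong : {A : Set} {f g : ℕ → A} → (∀ k → f k ≡ g k) →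
                   ∀ n → applyUpTo f n ≡ applyUpTo g n
  applyUpTo-cong eq zero    = refl
  applyUpTo-cong eq (suc n) = cong₂ _∷_ (eq 0) (applyUpTo-cong (eq ∘ suc) n)

  zipWith-applyUpTo : ∀ (f g : ℕ → ℤ) n →
    zipWith ℤ._*_ (applyUpTo f n) (applyUpTo g n) ≡ applyUpTo (λ k → f k ℤ.* g k) n
  zipWith-applyUpTo f g zero    = refl
  zipWith-applyUpTo f g (suc n) = cong (_ ∷_) (zipWith-applyUpTo (f ∘ suc) (g ∘ suc) n)

  recips-recip : ∀ B n → recips B n ≡ applyUpTo (λ k → recip B (n ∸ k)) (suc n)
  recips-recip B zero    = refl
  recips-recip B (suc n) = cong (recip B (suc n) ∷_) (recips-recip B n)

  ⊛-identityʳ : ∀ A n → (A ⊛ q^ 0) n ≡ A n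
  ⊛-identityʳ A zero    = trans (ℤ.+-identityʳ _) (ℤ.*-identityʳ (A 0))
  ⊛-identityʳ A (suc n) =
    trans (cong₂ ℤ._+_ (ℤ.*-zeroʳ (A 0)) (⊛-identityʳ (A ∘ suc) n)) (ℤ.+-identityˡ _)

  q^-above : ∀ {k n} → n < k → (q^ k) n ≡ 0ℤ
  q^-above {suc k} {zero}  _         = refl
  q^-above {suc k} {suc n} (s≤s n<k) = q^-above n<k

  pochhammer-step : ∀ {n N} → n ≤ N → pochhammer (suc N) n ≡ pochhammer N n
  pochhammer-step {n} {N} n≤N =
    trans (cong ∑ (applyUpTo-cong
            (λ k → cong (pochhammer N k ℤ.*_) (small (n ∸ k) (s≤s (≤-trans (m∸n≤m n k) n≤N))))
            (suc n)))
          (⊛-identityʳ (pochhammer N) n)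
    where
    small : ∀ j → j < suc N → (q^ 0 ⊖ q^ (suc N)) j ≡ (q^ 0) j
    small j j<  = trans (cong (λ z → (q^ 0) j ℤ.- z) (q^-above j<)) (ℤ.+-identityʳ _)

recip-correct : ∀ B → B 0 ≡ 1ℤ → B ⊛ recip B ≈ q^ 0
recip-correct B B₀ zero    = trans (ℤ.+-identityʳ _) (trans (ℤ.*-identityʳ (B 0)) B₀)
recip-correct B B₀ (suc n) =
  trans (cong (ℤ._+ rest) (trans (cong (ℤ._* recip B (suc n)) B₀) (ℤ.*-identityˡ _)))
 (trans (cong (λ z → ℤ.- z ℤ.+ rest) eq) (ℤ.+-inverseˡ rest))
  where
  rest : ℤ
  rest = ∑ (applyUpTo (λ k → B (suc k) ℤ.* recip B (n ∸ k)) (suc n))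
  eq : ∑ (zipWith ℤ._*_ (applyUpTo (B ∘ suc) (suc n)) (recips B n)) ≡ rest
  eq = cong ∑ (trans (cong (zipWith ℤ._*_ (applyUpTo (B ∘ suc) (suc n))) (recips-recip B n))
                     (zipWith-applyUpTo (B ∘ suc) (λ k → recip B (n ∸ k)) (suc n)))

pochhammer-stable : ∀ {n N} → n ≤ N → pochhammer N n ≡ pochhammer∞ n
pochhammer-stable = go ∘ ≤⇒≤′
  where
  go : ∀ {n N} → n ≤′ N → pochhammer N n ≡ pochhammer∞ n
  go (≤′-reflexive refl) = refl
  go (≤′-step n≤N)       = trans (pochhammer-step (≤′⇒≤ n≤N)) (go n≤N)

{-# OPTIONS --safe #-}
module Submission where

-- Record the Frobenius coordinates of λ as two finite sets A (arms) and B
-- (legs), and read t downwards to 0, stepping up when t ∈ A \ B and down when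
-- t ∈ B \ A.  Partitions thereby become walks from 0 to 0, the successive ranks
-- are nonnegative exactly when the walk stays nonnegative, and the diagonal
-- blocks of such a λ are the excursions of its walk, so that κ(λ) is the number
-- of steps from 1 to 0.  Weighted by binom(κ, m), the nonnegative walks are
-- counted by the reflection principle: their total is the total of the
-- walks ending at 2m minus that of the walks ending at 2m + 2.  By the Jacobi
-- triple product, walks ending at k have generating function
-- q^(k²/2) / (q;q)_∞, and k = 2m, 2m + 2 give the two terms.

open import Defs
open import Data.Bool using (Bool; true; false; if_then_else_)
open import Data.Empty using (⊥-elim)
open import Data.Integer as ℤ using (ℤ; 0ℤ; 1ℤ)
import Data.Integer.Properties as ℤ
import Data.Integer.Tactic.RingSolver as ℤSolver
open import Algebra.Properties.AbelianGroup ℤ.+-0-abelianGroup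
  using () renaming (∙-cancelʳ to +-cancelʳ)
open import Data.List
  using (List; []; _∷_; _++_; map; length; filter; concat; concatMap; applyUpTo; upTo)
open import Data.List.Extrema.Nat using (v≤max⁺; argmax-sel)
open import Data.List.Membership.Propositional using (_∈_; lose; find)
open import Data.List.Membership.Propositional.Properties
  using (∈-++⁺ˡ; ∈-++⁺ʳ; ∈-++⁻; ∈-map⁺; ∈-map⁻; ∈-∃++; ∈-filter⁺; ∈-filter⁻; ∈-applyUpTo⁺)
import Data.List.Properties as List
open import Data.List.Relation.Binary.Permutation.Propositional
  using (_↭_; prep; ↭-refl; ↭-trans; ↭-reflexive)
import Data.List.Relation.Binary.Permutation.Propositional.Properties as Perm
open import Data.List.Relation.Unary.All as All using (All; []; _∷_)
open import Data.List.Relation.Unary.All.Properties using (++⁺)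
open import Data.List.Relation.Unary.AllPairs using ([]; _∷_)
open import Data.List.Relation.Unary.Any using (here; there)
open import Data.List.Relation.Unary.Linked as Linked using (Linked; []; [-]; _∷_)
open import Data.List.Relation.Unary.Unique.Propositional using (Unique)
import Data.List.Relation.Unary.Unique.Propositional.Properties as Unique
open import Data.Nat
open import Data.Nat.Combinatorics
  using (_C_; nCk+nC[k+1]≡[n+1]C[k+1]; nCk≡nC[n∸k]; nCn≡1)
open import Data.Nat.ListAction using (sum)
open import Data.Nat.ListAction.Properties using (sum-++; sum-↭)
open import Data.Nat.Properties
open import Data.Nat.Tactic.RingSolver using (solve-∀)
open import Data.Product using (_×_; _,_; proj₁; proj₂; Σ-syntax; uncurry)
open import Data.Sum using (_⊎_; inj₁; inj₂)
open import Data.Vec using (Vec; []; _∷_)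
open import Function using (_∘_; id)
open import Relation.Binary.PropositionalEquality
open import Relation.Nullary using (¬_; ¬?; Dec; yes; no; contradiction)
open import Relation.Nullary.Decidable using (_×-dec_; does; dec-true; dec-false)
open import Relation.Unary using (Decidable)
open ≡-Reasoning

-- Delayed series and partitions in a box

-- An entry t of A or B stands for the half-integer t + 1/2, because the hooks give |λ| = ∑ (aᵢ + bᵢ
-- + 1). Doubling keeps all weights natural: a partition of n becomes a walk of weight 2n, the
-- lightest walk with displacement k has weight 1 + 3 + ... + (2k - 1) = k², and q² takes the place
-- of q in the counting of partitions. Walks are cut off at x steps. Their counts by end point are
-- then Gaussian binomials in q² times a power of q. The entries of A and B for a partition of n lie
-- below n, so any x ≥ n loses none of them. No partition is ever built from a walk. The walks from
-- 0 to 0 of weight 2n are counted as p(n) by the triple product itself, so injectivity of the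
-- Frobenius coordinates already makes them a bijection. The binomial weight suits the reflection
-- because of Pascal's rule: each of the m chosen steps from 1 to 0 moves both end points in the
-- difference by 2.

delay : {A : Set} → A → ℕ → (ℕ → A) → ℕ → A
delay z zero    f n       = f n
delay z (suc k) f zero    = z
delay z (suc k) f (suc n) = delay z k f n

delay₀ : ℕ → (ℕ → ℕ) → ℕ → ℕ
delay₀ = delay 0

module _ {A : Set} {z : A} where

  delay-cong : ∀ k {f g} → f ≗ g → delay z k f ≗ delay z k g
  delay-cong zero    eq n       = eq n
  delay-cong (suc k) eq zero    = refl
  delay-cong (suc k) eq (suc n) = delay-cong k eq n

  -- The filler is a parameter so that numbers, integers and lists can all be delayed; this lemma
  -- turns a delayed family of lists into the delayed series of their lengths or sums.
  delay-homo : {B : Set} (g : A → B) → ∀ k f n → g (delay z k f n) ≡ delay (g z) k (g ∘ f) n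
  delay-homo g zero    f n       = refl
  delay-homo g (suc k) f zero    = refl
  delay-homo g (suc k) f (suc n) = delay-homo g k f n

  delay-delay : ∀ k l f n → delay z k (delay z l f) n ≡ delay z (k + l) f n
  delay-delay zero    l f n       = refl
  delay-delay (suc k) l f zero    = refl
  delay-delay (suc k) l f (suc n) = delay-delay k l f n

  delay-shift : ∀ k f n → delay z k f (k + n) ≡ f n
  delay-shift zero    f n = refl
  delay-shift (suc k) f n = delay-shift k f n

delay-+ : ∀ k f g n → delay₀ k (λ i → f i + g i) n ≡ delay₀ k f n + delay₀ k g n
delay-+ zero    f g n       = refl
delay-+ (suc k) f g zero    = refl
delay-+ (suc k) f g (suc n) = delay-+ k f g n

delay-0 : ∀ k n → delay₀ k (λ _ → 0) n ≡ 0
delay-0 zero    n       = refl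
delay-0 (suc k) zero    = refl
delay-0 (suc k) (suc n) = delay-0 k n

δ : ℕ → ℕ
δ zero    = 1
δ (suc _) = 0

-- The coefficients of the Gaussian binomial of a + b over a: partitions of n with at most a parts,
-- each at most b. The recursion asks whether the largest part attains the bound.
boxCount : ℕ → ℕ → ℕ → ℕ
boxCount zero    b       = δ
boxCount (suc a) zero    = δ
boxCount (suc a) (suc b) n =
  boxCount (suc a) b n + delay₀ (suc b) (boxCount a (suc b)) n

boxCount-zeroʳ : ∀ a → boxCount a 0 ≗ δ
boxCount-zeroʳ zero    n = refl
boxCount-zeroʳ (suc a) n = refl

private
  interchange : ∀ w x y z → (w + x) + (y + z) ≡ (w + y) + (x + z)
  interchange = solve-∀

-- The other q-Pascal rule, which asks whether the first column has full length. It follows from the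
-- row rule because removing a row and then a column, or a column and then a row, costs the same
-- total degree (`corner`).
boxCount-column : ∀ a b n →
  boxCount (suc a) (suc b) n ≡ boxCount a (suc b) n + delay₀ (suc a) (boxCount (suc a) b) n
boxCount-column zero zero n = refl
boxCount-column zero (suc b) n = begin
  (boxCount 1 b n + delay₀ (suc b) δ n) + delay₀ (suc (suc b)) δ n
    ≡⟨ cong (_+ delay₀ (suc (suc b)) δ n) (boxCount-column zero b n) ⟩
  (δ n + delay₀ 1 (boxCount 1 b) n) + delay₀ (1 + suc b) δ n
    ≡⟨ cong ((δ n + delay₀ 1 (boxCount 1 b) n) +_) (delay-delay 1 (suc b) δ n) ⟨
  (δ n + delay₀ 1 (boxCount 1 b) n) + delay₀ 1 (delay₀ (suc b) δ) n
    ≡⟨ +-assoc (δ n) _ _ ⟩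
  δ n + (delay₀ 1 (boxCount 1 b) n + delay₀ 1 (delay₀ (suc b) δ) n)
    ≡⟨ cong (δ n +_) (delay-+ 1 (boxCount 1 b) (delay₀ (suc b) δ) n) ⟨
  δ n + delay₀ 1 (boxCount 1 (suc b)) n ∎
boxCount-column (suc a) zero n = begin
  δ n + delay₀ 1 (boxCount (suc a) 1) n
    ≡⟨ cong (δ n +_) (delay-cong 1 (boxCount-column a zero) n) ⟩
  δ n + delay₀ 1 (λ i → boxCount a 1 i + delay₀ (suc a) δ i) n
    ≡⟨ cong (δ n +_) (delay-+ 1 (boxCount a 1) (delay₀ (suc a) δ) n) ⟩
  δ n + (delay₀ 1 (boxCount a 1) n + delay₀ 1 (delay₀ (suc a) δ) n)
    ≡⟨ cong (λ e → δ n + (delay₀ 1 (boxCount a 1) n + e)) (delay-delay 1 (suc a) δ n) ⟩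
  δ n + (delay₀ 1 (boxCount a 1) n + delay₀ (suc (suc a)) δ n)
    ≡⟨ +-assoc (δ n) _ _ ⟨
  boxCount (suc a) 1 n + delay₀ (suc (suc a)) δ n ∎
boxCount-column (suc a) (suc b) n = begin
  Q (2 + a) (suc b) n + D (2 + b) (Q (suc a) (2 + b)) n
    ≡⟨ cong₂ _+_ (boxCount-column (suc a) b n)
                 (trans (delay-cong (2 + b) (boxCount-column a (suc b)) n)
                        (delay-+ (2 + b) (Q a (2 + b)) (D (suc a) (Q (suc a) (suc b))) n)) ⟩
  (Q (suc a) (suc b) n + D (2 + a) (Q (2 + a) b) n)
    + (D (2 + b) (Q a (2 + b)) n + D (2 + b) (D (suc a) (Q (suc a) (suc b))) n)
    ≡⟨ interchange (Q (suc a) (suc b) n) _ _ _ ⟩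
  (Q (suc a) (suc b) n + D (2 + b) (Q a (2 + b)) n)
    + (D (2 + a) (Q (2 + a) b) n + D (2 + b) (D (suc a) (Q (suc a) (suc b))) n)
    ≡⟨ cong (λ e → Q (suc a) (2 + b) n + (D (2 + a) (Q (2 + a) b) n + e)) corner ⟩
  Q (suc a) (2 + b) n
    + (D (2 + a) (Q (2 + a) b) n + D (2 + a) (D (suc b) (Q (suc a) (suc b))) n)
    ≡⟨ cong (Q (suc a) (2 + b) n +_)
            (delay-+ (2 + a) (Q (2 + a) b) (D (suc b) (Q (suc a) (suc b))) n) ⟨
  Q (suc a) (2 + b) n + D (2 + a) (Q (2 + a) (suc b)) n ∎
  where
  Q = boxCount
  D = delay₀
  degree : ∀ x y → (2 + x) + (1 + y) ≡ (2 + y) + (1 + x)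
  degree = solve-∀
  corner : D (2 + b) (D (suc a) (Q (suc a) (suc b))) n ≡ D (2 + a) (D (suc b) (Q (suc a) (suc b))) n
  corner = trans (delay-delay (2 + b) (suc a) (Q (suc a) (suc b)) n)
          (trans (cong (λ k → D k (Q (suc a) (suc b)) n) (degree b a))
                 (sym (delay-delay (2 + a) (suc b) (Q (suc a) (suc b)) n)))

boxCount-comm : ∀ a b → boxCount a b ≗ boxCount b a
boxCount-comm zero    b       n = sym (boxCount-zeroʳ b n)
boxCount-comm (suc a) zero    n = refl
boxCount-comm (suc a) (suc b) n = begin
  boxCount (suc a) b n + delay₀ (suc b) (boxCount a (suc b)) n
    ≡⟨ cong₂ _+_ (boxCount-comm (suc a) b n) (delay-cong (suc b) (boxCount-comm a (suc b)) n) ⟩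
  boxCount b (suc a) n + delay₀ (suc b) (boxCount (suc b) a) n
    ≡⟨ boxCount-column b a n ⟨
  boxCount (suc b) (suc a) n ∎

-- boxCountPred a b is boxCount (a - 1) b, with the value 0 at a = 0.
boxCountPred : ℕ → ℕ → ℕ → ℕ
boxCountPred zero    b _ = 0
boxCountPred (suc a) b   = boxCount a b

boxCount-row : ∀ a b n →
  boxCount a (suc b) n ≡ boxCount a b n + delay₀ (suc b) (boxCountPred a (suc b)) n
boxCount-row zero    b n = sym (trans (cong (δ n +_) (delay-0 (suc b) n)) (+-identityʳ (δ n)))
boxCount-row (suc a) b n = refl

-- The four cases are whether the first row and the first column have full
-- length.
boxCount-peel : ∀ a b n →
  boxCount (suc a) (2 + b) n ≡
    (boxCount a (suc b) n + delay₀ (2 + (a + b)) (boxCount a (suc b)) n)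
    + (delay₀ (2 + b) (boxCountPred a (2 + b)) n + delay₀ (suc a) (boxCount (suc a) b) n)
boxCount-peel a b n = begin
  Q (suc a) (2 + b) n
    ≡⟨ boxCount-column a (suc b) n ⟩
  Q a (2 + b) n + D (suc a) (Q (suc a) (suc b)) n
    ≡⟨ cong₂ _+_ (boxCount-row a (suc b) n)
            (trans (delay-+ (suc a) (Q (suc a) b) (D (suc b) (Q a (suc b))) n)
                   (cong (D (suc a) (Q (suc a) b) n +_)
                         (trans (delay-delay (suc a) (suc b) (Q a (suc b)) n)
                                (cong (λ k → D k (Q a (suc b)) n) (degree a b))))) ⟩
  (Q a (suc b) n + D (2 + b) (boxCountPred a (2 + b)) n)
    + (D (suc a) (Q (suc a) b) n + D (2 + (a + b)) (Q a (suc b)) n)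
    ≡⟨ rearrange (Q a (suc b) n) _ _ _ ⟩
  (Q a (suc b) n + D (2 + (a + b)) (Q a (suc b)) n)
    + (D (2 + b) (boxCountPred a (2 + b)) n + D (suc a) (Q (suc a) b) n) ∎
  where
  Q = boxCount
  D = delay₀
  degree : ∀ x y → (1 + x) + (1 + y) ≡ 2 + (x + y)
  degree = solve-∀
  rearrange : ∀ w x y z → (w + x) + (y + z) ≡ (w + z) + (x + y)
  rearrange = solve-∀

boxCount-at-0 : ∀ a b → boxCount a b 0 ≡ 1
boxCount-at-0 zero    b       = refl
boxCount-at-0 (suc a) zero    = refl
boxCount-at-0 (suc a) (suc b) = trans (+-identityʳ _) (boxCount-at-0 (suc a) b)

delay-cong-≤ : ∀ k {f g n} → (∀ {i} → i + k ≤ n → f i ≡ g i) → delay₀ k f n ≡ delay₀ k g n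
delay-cong-≤ zero    {n = n}     eq = eq (≤-reflexive (+-identityʳ n))
delay-cong-≤ (suc k) {n = zero}  eq = refl
delay-cong-≤ (suc k) {n = suc n} eq =
  delay-cong-≤ k (λ {i} i+k≤n → eq (subst (_≤ suc n) (sym (+-suc i k)) (s≤s i+k≤n)))

boxCount-stable : ∀ {n a a′} b → n ≤ a → n ≤ a′ → boxCount a b n ≡ boxCount a′ b n
boxCount-stable {a = zero} {a′} b z≤n _ = sym (boxCount-at-0 a′ b)
boxCount-stable {a = suc a} {zero} b _ z≤n = boxCount-at-0 (suc a) b
boxCount-stable {a = suc a} {suc a′} zero _ _ = refl
boxCount-stable {n} {suc a} {suc a′} (suc b) n≤a n≤a′ =
  cong₂ _+_ (boxCount-stable b n≤a n≤a′)
            (delay-cong-≤ (suc b) (λ le → boxCount-stable (suc b) (smaller le n≤a) (smaller le n≤a′)))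
  where
  smaller : ∀ {i c} → i + suc b ≤ n → n ≤ suc c → i ≤ c
  smaller {i} le n≤ =
    ≤-trans (m≤m+n i b) (s≤s⁻¹ (≤-trans (subst (_≤ n) (+-suc i b) le) n≤))

-- Walks with a given end point

-- dilate f is the series f(q²).
dilate : (ℕ → ℕ) → ℕ → ℕ
dilate f zero          = f 0
dilate f (suc zero)    = 0
dilate f (suc (suc n)) = dilate (f ∘ suc) n

dilate-cong : ∀ {f g} → f ≗ g → dilate f ≗ dilate g
dilate-cong eq zero          = eq 0
dilate-cong eq (suc zero)    = refl
dilate-cong eq (suc (suc n)) = dilate-cong (eq ∘ suc) n

dilate-+ : ∀ f g n → dilate (λ i → f i + g i) n ≡ dilate f n + dilate g n
dilate-+ f g zero          = refl
dilate-+ f g (suc zero)    = refl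
dilate-+ f g (suc (suc n)) = dilate-+ (f ∘ suc) (g ∘ suc) n

dilate-0 : ∀ n → dilate (λ _ → 0) n ≡ 0
dilate-0 zero          = refl
dilate-0 (suc zero)    = refl
dilate-0 (suc (suc n)) = dilate-0 n

dilate-delay : ∀ k f n → dilate (delay₀ k f) n ≡ delay₀ (k + k) (dilate f) n
dilate-delay zero    f n             = refl
dilate-delay (suc k) f zero          = refl
dilate-delay (suc k) f (suc zero)    rewrite +-suc k k = refl
dilate-delay (suc k) f (suc (suc n)) rewrite +-suc k k = dilate-delay k f n

dilate-double : ∀ f n → dilate f (n + n) ≡ f n
dilate-double f zero    = refl
dilate-double f (suc n) rewrite +-suc n n = dilate-double (f ∘ suc) n

-- The weight 2t + 1 of a step at position t is twice the half-integer t + ½.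
stepWeight : ℕ → ℕ
stepWeight t = suc (t + t)

-- The weighted number of walks with x steps and total displacement k, which
-- is also the number with displacement - k.
endCount : ℕ → ℕ → ℕ → ℕ
endCount zero    zero      = δ
endCount zero    (suc k) n = 0
endCount (suc x) zero    n =
  (endCount x 0 n + delay₀ (stepWeight x + stepWeight x) (endCount x 0) n)
  + (delay₀ (stepWeight x) (endCount x 1) n + delay₀ (stepWeight x) (endCount x 1) n)
endCount (suc x) (suc k) n =
  (endCount x (suc k) n + delay₀ (stepWeight x + stepWeight x) (endCount x (suc k)) n)
  + (delay₀ (stepWeight x) (endCount x (2 + k)) n + delay₀ (stepWeight x) (endCount x k) n)

endCount-above : ∀ {x k} → x < k → endCount x k ≗ λ _ → 0
endCount-above {zero}  {suc k} _         n = refl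
endCount-above {suc x} {suc k} (s≤s x<k) n =
  cong₂ _+_
    (cong₂ _+_ (endCount-above (m<n⇒m<1+n x<k) n)
               (vanish (stepWeight x + stepWeight x) (endCount-above (m<n⇒m<1+n x<k))))
    (cong₂ _+_ (vanish (stepWeight x) (endCount-above (m<n⇒m<1+n (m<n⇒m<1+n x<k))))
               (vanish (stepWeight x) (endCount-above x<k)))
  where
  vanish : ∀ c {f : ℕ → ℕ} → (f ≗ λ _ → 0) → delay₀ c f n ≡ 0
  vanish c f≗0 = trans (delay-cong c f≗0 n) (delay-0 c n)

private
  scaled : ℕ → (ℕ → ℕ) → ℕ → ℕ
  scaled s f = delay₀ s (dilate f)

  scaled-cong : ∀ s {f g} → f ≗ g → scaled s f ≗ scaled s g
  scaled-cong s eq = delay-cong s (dilate-cong eq)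

  scaled-+ : ∀ s f g n → scaled s (λ i → f i + g i) n ≡ scaled s f n + scaled s g n
  scaled-+ s f g n =
    trans (delay-cong s (dilate-+ f g) n) (delay-+ s (dilate f) (dilate g) n)

  -- Rescaling q^s f(q²) moves a factor q^c of f to q^(2c).
  scaled-delay : ∀ s c t u f n → s + (c + c) ≡ t + u →
    scaled s (delay₀ c f) n ≡ delay₀ t (scaled u f) n
  scaled-delay s c t u f n eq = begin
    delay₀ s (dilate (delay₀ c f)) n
      ≡⟨ delay-cong s (dilate-delay c f) n ⟩
    delay₀ s (delay₀ (c + c) (dilate f)) n
      ≡⟨ delay-delay s (c + c) (dilate f) n ⟩
    delay₀ (s + (c + c)) (dilate f) n
      ≡⟨ cong (λ e → delay₀ e (dilate f) n) eq ⟩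
    delay₀ (t + u) (dilate f) n
      ≡⟨ delay-delay t u (dilate f) n ⟨
    delay₀ t (delay₀ u (dilate f)) n ∎

  scaled-four : ∀ s f g h i n →
    scaled s (λ j → (f j + g j) + (h j + i j)) n ≡
      (scaled s f n + scaled s g n) + (scaled s h n + scaled s i n)
  scaled-four s f g h i n =
    trans (scaled-+ s (λ j → f j + g j) (λ j → h j + i j) n)
          (cong₂ _+_ (scaled-+ s f g n) (scaled-+ s h i n))

  -- Displacement 0 is special: both of its neighbours, 1 and -1, are counted by
  -- `endCount (suc x) 1`. Peeling the square box gives an x × (x + 2) box and its transpose, so
  -- `boxCount-comm` is what identifies the two terms.
  centre : ∀ x a → a ≡ x →
    endCount (suc x) 0 ≗ dilate (boxCount (suc a) (suc x)) →
    endCount (suc x) 1 ≗ delay₀ 1 (dilate (boxCount a (2 + x))) →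
    endCount (2 + x) 0 ≗ dilate (boxCount (2 + a) (2 + (x + 0)))
  centre x x refl flat slope n = sym (begin
    scaled 0 (Q (2 + x) (2 + (x + 0))) n
      ≡⟨ cong (λ z → scaled 0 (Q (2 + x) (2 + z)) n) (+-identityʳ x) ⟩
    scaled 0 (Q (2 + x) (2 + x)) n
      ≡⟨ scaled-cong 0 (boxCount-peel (suc x) x) n ⟩
    scaled 0 (λ i → (Q y y i + D (2 + (y + x)) (Q y y) i)
                    + (D (2 + x) (Q x (2 + x)) i + D (2 + x) (Q (2 + x) x) i)) n
      ≡⟨ scaled-four 0 (Q y y) _ _ _ n ⟩
    (scaled 0 (Q y y) n + scaled 0 (D (2 + (y + x)) (Q y y)) n)
      + (scaled 0 (D (2 + x) (Q x (2 + x))) n + scaled 0 (D (2 + x) (Q (2 + x) x)) n)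
      ≡⟨ cong₂ _+_
           (cong₂ _+_ (sym (flat n))
             (trans (scaled-delay 0 (2 + (y + x)) (w + w) 0 (Q y y) n (degree₀ x))
                    (delay-cong (w + w) (λ i → sym (flat i)) n)))
           (cong₂ _+_ (sym slope′)
             (trans (scaled-cong 0 (delay-cong (2 + x) (boxCount-comm (2 + x) x)) n)
                    (sym slope′))) ⟩
    endCount (suc y) 0 n ∎)
    where
    Q = boxCount
    D = delay₀
    y = suc x
    w = stepWeight y
    degree₀ : ∀ a → 0 + ((2 + (suc a + a)) + (2 + (suc a + a)))
                    ≡ (suc (suc a + suc a) + suc (suc a + suc a)) + 0
    degree₀ = solve-∀
    degree₁ : ∀ a → 0 + ((2 + a) + (2 + a)) ≡ suc (suc a + suc a) + 1
    degree₁ = solve-∀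
    slope′ : D w (endCount y 1) n ≡ scaled 0 (D (2 + x) (Q x (2 + x))) n
    slope′ = trans (delay-cong w slope n)
                   (sym (scaled-delay 0 (2 + x) w 1 (Q x (2 + x)) n (degree₁ x)))

-- The finite Jacobi triple product.
endCount-boxCount : ∀ x a b k → a + k ≡ x → b ≡ x + k →
  endCount x k ≗ delay₀ (k * k) (dilate (boxCount a b))

private
  -- A neighbouring displacement further from 0 shrinks the side a. When a is already 0, that
  -- displacement exceeds the number of steps and both sides vanish, which is why `boxCountPred`
  -- takes the value 0 there.
  endCount-boxCountPred : ∀ x a b k → a + k ≡ x → b ≡ suc (x + k) →
    endCount x (suc k) ≗ delay₀ (suc k * suc k) (dilate (boxCountPred a b))
  endCount-boxCountPred x zero b k refl refl n =
    trans (endCount-above (n<1+n x) n)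
          (sym (trans (delay-cong (suc k * suc k) dilate-0 n) (delay-0 (suc k * suc k) n)))
  endCount-boxCountPred x (suc a) b k refl refl n =
    endCount-boxCount x a b (suc k) (+-suc a k) (sym (+-suc x k)) n

endCount-boxCount zero zero b zero refl refl n = lemma n
  where
  lemma : δ ≗ dilate δ
  lemma zero          = refl
  lemma (suc zero)    = refl
  lemma (suc (suc n)) = sym (dilate-0 n)
-- The displacement equals the number of steps, so only the straight walk survives; its topmost step
-- adds 2k + 1 to k².
endCount-boxCount (suc x) zero b (suc k) refl refl n = begin
  (endCount k (suc k) n + delay₀ (stepWeight k + stepWeight k) (endCount k (suc k)) n)
    + (delay₀ (stepWeight k) (endCount k (2 + k)) n + delay₀ (stepWeight k) (endCount k k) n)
    ≡⟨ cong₂ _+_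
         (cong₂ _+_ (endCount-above (n<1+n k) n)
                    (vanish (stepWeight k + stepWeight k) (endCount-above (n<1+n k))))
         (cong (_+ delay₀ (stepWeight k) (endCount k k) n)
               (vanish (stepWeight k) (endCount-above (m<n⇒m<1+n (n<1+n k))))) ⟩
  delay₀ (stepWeight k) (endCount k k) n
    ≡⟨ delay-cong (stepWeight k) (endCount-boxCount k 0 (k + k) k refl refl) n ⟩
  delay₀ (stepWeight k) (scaled (k * k) δ) n
    ≡⟨ scaled-delay (suc k * suc k) 0 (stepWeight k) (k * k) δ n (degree k) ⟨
  scaled (suc k * suc k) δ n ∎
  where
  vanish : ∀ c {f : ℕ → ℕ} → (f ≗ λ _ → 0) → delay₀ c f n ≡ 0
  vanish c f≗0 = trans (delay-cong c f≗0 n) (delay-0 c n)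
  degree : ∀ k → suc k * suc k + 0 ≡ suc (k + k) + k * k
  degree = solve-∀
endCount-boxCount (suc zero) (suc zero) b zero refl refl n = sym (begin
  dilate (λ i → δ i + delay₀ 1 δ i) n
    ≡⟨ dilate-+ δ (delay₀ 1 δ) n ⟩
  dilate δ n + dilate (delay₀ 1 δ) n
    ≡⟨ cong₂ _+_ (sym (endCount-boxCount 0 0 0 0 refl refl n))
         (trans (scaled-delay 0 1 2 0 δ n refl)
                (delay-cong 2 (λ i → sym (endCount-boxCount 0 0 0 0 refl refl i)) n)) ⟩
  δ n + delay₀ 2 δ n
    ≡⟨ +-identityʳ _ ⟨
  (δ n + delay₀ 2 δ n) + 0
    ≡⟨ cong ((δ n + delay₀ 2 δ n) +_) (cong₂ _+_ (delay-0 1 n) (delay-0 1 n)) ⟨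
  (δ n + delay₀ 2 δ n) + (delay₀ 1 (λ _ → 0) n + delay₀ 1 (λ _ → 0) n) ∎)
endCount-boxCount (suc (suc x)) (suc (suc a)) b zero a≡x refl =
  centre x a (suc-injective (suc-injective (trans (sym (+-identityʳ (2 + a))) a≡x)))
    (endCount-boxCount (suc x) (suc a) (suc x) 0 (suc-injective a≡x) (sym (+-identityʳ (suc x))))
    (endCount-boxCount (suc x) a (2 + x) 1
      (trans (+-comm a 1) (trans (sym (+-identityʳ (suc a))) (suc-injective a≡x)))
      (sym (+-comm (suc x) 1)))
endCount-boxCount (suc x) (suc a) b (suc k) refl refl n = sym (begin
  scaled s (Q (suc a) (suc (x + suc k))) n
    ≡⟨ cong (λ z → scaled s (Q (suc a) (suc z)) n) (+-suc x k) ⟩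
  scaled s (Q (suc a) (2 + c)) n
    ≡⟨ scaled-cong s (boxCount-peel a c) n ⟩
  scaled s (λ i → (Q a (suc c) i + D (2 + (a + c)) (Q a (suc c)) i)
                  + (D (2 + c) (boxCountPred a (2 + c)) i + D (suc a) (Q (suc a) c) i)) n
    ≡⟨ scaled-four s (Q a (suc c)) _ _ _ n ⟩
  (scaled s (Q a (suc c)) n + scaled s (D (2 + (a + c)) (Q a (suc c))) n)
    + (scaled s (D (2 + c) (boxCountPred a (2 + c))) n + scaled s (D (suc a) (Q (suc a) c)) n)
    -- The four terms of `boxCount-peel` are the four possible letters at position x; the degree
    -- identities compare exponents after dilation has doubled those inside the box.
    ≡⟨ cong₂ _+_
         (cong₂ _+_ (sym (flat n))
           (trans (scaled-delay s (2 + (a + c)) (stepWeight x + stepWeight x) s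
                                (Q a (suc c)) n (degree₀ a k))
                  (delay-cong (stepWeight x + stepWeight x) (λ i → sym (flat i)) n)))
         (cong₂ _+_
           (trans (scaled-delay s (2 + c) (stepWeight x) (suc (suc k) * suc (suc k))
                                (boxCountPred a (2 + c)) n (degree₁ a k))
                  (delay-cong (stepWeight x)
                    (λ i → sym (endCount-boxCountPred x a (2 + c) (suc k) refl
                                  (cong suc (sym (+-suc x k))) i)) n))
           (trans (scaled-delay s (suc a) (stepWeight x) (k * k) (Q (suc a) c) n (degree₂ a k))
                  (delay-cong (stepWeight x)
                    (λ i → sym (endCount-boxCount x (suc a) c k (sym (+-suc a k)) refl i)) n))) ⟩
  endCount (suc x) (suc k) n ∎)
  where
  Q = boxCount
  D = delay₀
  s = suc k * suc k
  c = x + k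
  flat : endCount x (suc k) ≗ scaled s (Q a (suc c))
  flat = endCount-boxCount x a (suc c) (suc k) refl (sym (+-suc x k))
  degree₀ : ∀ a k → suc k * suc k + ((2 + (a + ((a + suc k) + k))) + (2 + (a + ((a + suc k) + k))))
                    ≡ (suc ((a + suc k) + (a + suc k)) + suc ((a + suc k) + (a + suc k))) + suc k * suc k
  degree₀ = solve-∀
  degree₁ : ∀ a k → suc k * suc k + ((2 + ((a + suc k) + k)) + (2 + ((a + suc k) + k)))
                    ≡ suc ((a + suc k) + (a + suc k)) + (2 + k) * (2 + k)
  degree₁ = solve-∀
  degree₂ : ∀ a k → suc k * suc k + (suc a + suc a) ≡ suc ((a + suc k) + (a + suc k)) + k * k
  degree₂ = solve-∀

-- The reflection principle

-- The head of a word of length x + 1 records whether x lies in A and whether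
-- it lies in B.
Word : ℕ → Set
Word = Vec (Bool × Bool)

pattern level = (false , false)
pattern both  = (true , true)
pattern up    = (true , false)
pattern down  = (false , true)

-- Graded by weight and built in four blocks, so that every `total` obeys a recurrence of the same
-- form as `endCount`. The letter `both` pays twice because x is then an entry of A and of B.
words : ∀ x → ℕ → List (Word x)
words zero    zero    = [] ∷ []
words zero    (suc N) = []
words (suc x) N =
  (map (level ∷_) (words x N)
    ++ map (both ∷_) (delay [] (stepWeight x + stepWeight x) (words x) N))
  ++ (map (up ∷_) (delay [] (stepWeight x) (words x) N)
    ++ map (down ∷_) (delay [] (stepWeight x) (words x) N))

total : ∀ x → (Word x → ℕ) → ℕ → ℕ
total x f N = sum (map f (words x N))

total-suc : ∀ x f N → total (suc x) f N ≡
  (total x (f ∘ (level ∷_)) N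
    + delay₀ (stepWeight x + stepWeight x) (total x (f ∘ (both ∷_))) N)
  + (delay₀ (stepWeight x) (total x (f ∘ (up ∷_))) N
    + delay₀ (stepWeight x) (total x (f ∘ (down ∷_))) N)
total-suc x f N =
  trans (sum-map-++ (map (level ∷_) (words x N) ++ _) _)
    (cong₂ _+_
      (trans (sum-map-++ (map (level ∷_) (words x N)) _)
             (cong₂ _+_ (cong sum (sym (List.map-∘ (words x N)))) (part both (stepWeight x + stepWeight x))))
      (trans (sum-map-++ (map (up ∷_) (delay [] (stepWeight x) (words x) N)) _)
             (cong₂ _+_ (part up (stepWeight x)) (part down (stepWeight x)))))
  where
  sum-map-++ : ∀ us vs → sum (map f (us ++ vs)) ≡ sum (map f us) + sum (map f vs)
  sum-map-++ us vs = trans (cong sum (List.map-++ f us vs)) (sum-++ (map f us) (map f vs))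
  part : ∀ l c → sum (map f (map (l ∷_) (delay [] c (words x) N))) ≡
                 delay₀ c (total x (f ∘ (l ∷_))) N
  part l c = trans (cong sum (sym (List.map-∘ (delay [] c (words x) N))))
                   (delay-homo (sum ∘ map (f ∘ (l ∷_))) c (words x) N)

total-+ : ∀ x f g N → total x (λ w → f w + g w) N ≡ total x f N + total x g N
total-+ x f g N = lemma (words x N)
  where
  lemma : ∀ ws → sum (map (λ w → f w + g w) ws) ≡ sum (map f ws) + sum (map g ws)
  lemma []       = refl
  lemma (w ∷ ws) = trans (cong (f w + g w +_) (lemma ws))
                         (interchange (f w) (g w) (sum (map f ws)) (sum (map g ws)))

total-0 : ∀ x N → total x (λ _ → 0) N ≡ 0
total-0 x N = lemma (words x N)
  where
  lemma : ∀ ws → sum (map (λ _ → 0) ws) ≡ 0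
  lemma []       = refl
  lemma (_ ∷ ws) = lemma ws

private
  atOrigin : ℕ → ℕ → ℕ
  atOrigin zero zero = 1
  atOrigin _    _    = 0

-- walkValue h m w is binom(r, m) if the walk w from height h ends at 0 and
-- stays nonnegative, where r is its number of steps from 1 to 0; otherwise 0.
walkValue : ∀ {x} → ℕ → ℕ → Word x → ℕ
walkValue h             m       []          = atOrigin h m
walkValue h             m       (level ∷ w) = walkValue h m w
walkValue h             m       (both ∷ w)  = walkValue h m w
walkValue h             m       (up ∷ w)    = walkValue (suc h) m w
walkValue zero          m       (down ∷ w)  = 0
walkValue (suc zero)    zero    (down ∷ w)  = walkValue 0 0 w
-- Pascal's rule: this step raises r by 1, and binom(r + 1, m + 1) = binom(r, m + 1) + binom(r, m).
walkValue (suc zero)    (suc m) (down ∷ w)  = walkValue 0 (suc m) w + walkValue 0 m w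
walkValue (suc (suc h)) m       (down ∷ w)  = walkValue (suc h) m w

walkTotal : ℕ → ℕ → ℕ → ℕ → ℕ
walkTotal x h m = total x (walkValue h m)

double : ℕ → ℕ
double zero    = zero
double (suc m) = suc (suc (double m))

private
  -- The induction step common to all heights. The total is the count for end point `lo` minus that
  -- for K + 1, written additively to stay in ℕ. `U` and `L` are left open because at height 0 the
  -- two neighbours of `lo` occur in exchanged order.
  walkTotal-step : ∀ x h m K lo {U L : ℕ → ℕ} →
    (∀ i → walkTotal x h m i + endCount x (suc K) i ≡ endCount x lo i) →
    (∀ i → walkTotal x (suc h) m i + endCount x (2 + K) i ≡ U i) →
    (∀ i → total x (λ w → walkValue h m (down ∷ w)) i + endCount x K i ≡ L i) →
    ∀ N →
    endCount (suc x) lo N ≡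
      (endCount x lo N + delay₀ (stepWeight x + stepWeight x) (endCount x lo) N)
      + (delay₀ (stepWeight x) U N + delay₀ (stepWeight x) L N) →
    walkTotal (suc x) h m N + endCount (suc x) (suc K) N ≡ endCount (suc x) lo N
  walkTotal-step x h m K lo {U} {L} flat rise fall N eq = begin
    walkTotal (suc x) h m N + endCount (suc x) (suc K) N
      ≡⟨ cong (_+ endCount (suc x) (suc K) N) (total-suc x (walkValue h m) N) ⟩
    ((walkTotal x h m N + delay₀ c (walkTotal x h m) N)
      + (delay₀ w (walkTotal x (suc h) m) N + delay₀ w fallen N))
    + ((endCount x (suc K) N + delay₀ c (endCount x (suc K)) N)
      + (delay₀ w (endCount x (2 + K)) N + delay₀ w (endCount x K) N))
      ≡⟨ shuffle (walkTotal x h m N) _ (delay₀ w (walkTotal x (suc h) m) N) _ (endCount x (suc K) N) _ _ _ ⟩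
    ((walkTotal x h m N + endCount x (suc K) N)
      + (delay₀ c (walkTotal x h m) N + delay₀ c (endCount x (suc K)) N))
    + ((delay₀ w (walkTotal x (suc h) m) N + delay₀ w (endCount x (2 + K)) N)
      + (delay₀ w fallen N + delay₀ w (endCount x K) N))
      ≡⟨ cong₂ _+_ (cong₂ _+_ (flat N) (delay-sum c flat))
                   (cong₂ _+_ (delay-sum w rise) (delay-sum w fall)) ⟩
    (endCount x lo N + delay₀ c (endCount x lo) N) + (delay₀ w U N + delay₀ w L N)
      ≡⟨ eq ⟨
    endCount (suc x) lo N ∎
    where
    w c : ℕ
    w = stepWeight x
    c = w + w
    fallen : ℕ → ℕ
    fallen = total x (λ v → walkValue h m (down ∷ v))
    delay-sum : ∀ k {f g h : ℕ → ℕ} → (∀ i → f i + g i ≡ h i) →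
                delay₀ k f N + delay₀ k g N ≡ delay₀ k h N
    delay-sum k {f} {g} sums = trans (sym (delay-+ k f g N)) (delay-cong k sums N)
    shuffle : ∀ a b c d a′ b′ c′ d′ →
      ((a + b) + (c + d)) + ((a′ + b′) + (c′ + d′))
        ≡ ((a + a′) + (b + b′)) + ((c + c′) + (d + d′))
    shuffle = solve-∀

-- In the height h both sides satisfy the same recurrence, and they agree for
-- x = 0.
walkTotal-origin : ∀ x m N →
  walkTotal x 0 m N + endCount x (2 + double m) N ≡ endCount x (double m) N

walkTotal-above-0 : ∀ x h N →
  walkTotal x (suc h) 0 N + endCount x (3 + h) N ≡ endCount x (suc h) N

-- For a positive binomial index the end points differ by 4 instead of 2. By Pascal's rule a step
-- from 1 to 0 adds the values at height 0 for m + 1 and for m; these two differences share the end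
-- point 2m + 2 and telescope.
walkTotal-above : ∀ x h m N →
  walkTotal x (suc h) (suc m) N + endCount x (5 + (h + double m)) N
    ≡ endCount x (suc (h + double m)) N

walkTotal-origin zero zero    zero    = refl
walkTotal-origin zero (suc m) zero    = refl
walkTotal-origin zero zero    (suc N) = refl
walkTotal-origin zero (suc m) (suc N) = refl
walkTotal-origin (suc x) zero N =
  walkTotal-step x 0 0 1 0 (walkTotal-origin x 0) (walkTotal-above-0 x 0)
    (λ i → cong (_+ endCount x 1 i) (total-0 x i)) N refl
walkTotal-origin (suc x) (suc m) N =
  walkTotal-step x 0 (suc m) (3 + double m) (2 + double m)
    (walkTotal-origin x (suc m)) (walkTotal-above x 0 m)
    (λ i → cong (_+ endCount x (3 + double m) i) (total-0 x i)) N
    -- The reflection happens here: at height 0 the upward step yields the end point 2m + 1, and the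
    -- forbidden downward step leaves 2m + 3, opposite to their order in the recurrence for 2m + 2.
    (cong ((endCount x (2 + double m) N
              + delay₀ (stepWeight x + stepWeight x) (endCount x (2 + double m)) N) +_)
          (+-comm (delay₀ (stepWeight x) (endCount x (3 + double m)) N)
                  (delay₀ (stepWeight x) (endCount x (1 + double m)) N)))

walkTotal-above-0 zero h zero    = refl
walkTotal-above-0 zero h (suc N) = refl
walkTotal-above-0 (suc x) zero N =
  walkTotal-step x 1 0 2 1 (walkTotal-above-0 x 0) (walkTotal-above-0 x 1)
    (walkTotal-origin x 0) N refl
walkTotal-above-0 (suc x) (suc h) N =
  walkTotal-step x (2 + h) 0 (3 + h) (2 + h)
    (walkTotal-above-0 x (suc h)) (walkTotal-above-0 x (2 + h)) (walkTotal-above-0 x h) N refl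

walkTotal-above zero h m zero    = refl
walkTotal-above zero h m (suc N) = refl
walkTotal-above (suc x) zero m N =
  walkTotal-step x 1 (suc m) (4 + double m) (1 + double m)
    (walkTotal-above x 0 m) (walkTotal-above x 1 m) land N refl
  where
  swap : ∀ a b c → (a + b) + c ≡ b + (a + c)
  swap = solve-∀
  land : ∀ i → total x (λ w → walkValue 1 (suc m) (down ∷ w)) i + endCount x (4 + double m) i
               ≡ endCount x (double m) i
  land i = begin
    total x (λ w → walkValue 1 (suc m) (down ∷ w)) i + endCount x (4 + double m) i
      ≡⟨ cong (_+ endCount x (4 + double m) i) (total-+ x (walkValue 0 (suc m)) (walkValue 0 m) i) ⟩
    (walkTotal x 0 (suc m) i + walkTotal x 0 m i) + endCount x (4 + double m) i
      ≡⟨ swap (walkTotal x 0 (suc m) i) (walkTotal x 0 m i) _ ⟩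
    walkTotal x 0 m i + (walkTotal x 0 (suc m) i + endCount x (4 + double m) i)
      ≡⟨ cong (walkTotal x 0 m i +_) (walkTotal-origin x (suc m) i) ⟩
    walkTotal x 0 m i + endCount x (2 + double m) i
      ≡⟨ walkTotal-origin x m i ⟩
    endCount x (double m) i ∎
walkTotal-above (suc x) (suc h) m N =
  walkTotal-step x (2 + h) (suc m) (5 + (h + double m)) (2 + (h + double m))
    (walkTotal-above x (suc h) m) (walkTotal-above x (2 + h) m) (walkTotal-above x h m) N refl

-- Walks as pairs of descending lists

private
  agree : ℕ → ℕ → ℕ
  agree zero    zero    = 1
  agree (suc u) (suc v) = agree u v
  agree _       _       = 0

  agree-refl : ∀ u → agree u u ≡ 1
  agree-refl zero    = refl
  agree-refl (suc u) = agree-refl u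

-- bridge u v w is 1 if the walk w has displacement v - u, and 0 otherwise.
bridge : ∀ {x} → ℕ → ℕ → Word x → ℕ
bridge u v []          = agree u v
bridge u v (level ∷ w) = bridge u v w
bridge u v (both ∷ w)  = bridge u v w
bridge u v (up ∷ w)    = bridge (suc u) v w
bridge u v (down ∷ w)  = bridge u (suc v) w

bridge-suc : ∀ {x} u v (w : Word x) → bridge (suc u) (suc v) w ≡ bridge u v w
bridge-suc u v []          = refl
bridge-suc u v (level ∷ w) = bridge-suc u v w
bridge-suc u v (both ∷ w)  = bridge-suc u v w
bridge-suc u v (up ∷ w)    = bridge-suc (suc u) v w
bridge-suc u v (down ∷ w)  = bridge-suc u (suc v) w

bridge-≤1 : ∀ {x} u v (w : Word x) → bridge u v w ≤ 1
bridge-≤1 zero    zero    []          = ≤-refl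
bridge-≤1 zero    (suc v) []          = z≤n
bridge-≤1 (suc u) zero    []          = z≤n
bridge-≤1 (suc u) (suc v) []          = bridge-≤1 u v []
bridge-≤1 u       v       (level ∷ w) = bridge-≤1 u v w
bridge-≤1 u       v       (both ∷ w)  = bridge-≤1 u v w
bridge-≤1 u       v       (up ∷ w)    = bridge-≤1 (suc u) v w
bridge-≤1 u       v       (down ∷ w)  = bridge-≤1 u (suc v) w

total-cong : ∀ x {f g : Word x → ℕ} → f ≗ g → total x f ≗ total x g
total-cong x {f} {g} eq N = lemma (words x N)
  where
  lemma : ∀ ws → sum (map f ws) ≡ sum (map g ws)
  lemma []       = refl
  lemma (w ∷ ws) = cong₂ _+_ (eq w) (lemma ws)

mutual
  -- Exchanging A and B preserves weights, so both signs of the displacement have the same count.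
  -- The two signs are treated together because from displacement 0 the two kinds of step lead to
  -- opposite signs.
  total-bridge-up : ∀ x k → total x (bridge k 0) ≗ endCount x k
  total-bridge-up zero    zero    zero    = refl
  total-bridge-up zero    zero    (suc N) = refl
  total-bridge-up zero    (suc k) zero    = refl
  total-bridge-up zero    (suc k) (suc N) = refl
  total-bridge-up (suc x) zero N =
    trans (total-suc x (bridge 0 0) N)
      (cong₂ _+_
        (cong₂ _+_ (total-bridge-up x 0 N) (delay-cong (w + w) (total-bridge-up x 0) N))
        (cong₂ _+_ (delay-cong w (total-bridge-up x 1) N) (delay-cong w (total-bridge-down x 1) N)))
    where w = stepWeight x
  total-bridge-up (suc x) (suc k) N =
    trans (total-suc x (bridge (suc k) 0) N)
      (cong₂ _+_
        (cong₂ _+_ (total-bridge-up x (suc k) N) (delay-cong (w + w) (total-bridge-up x (suc k)) N))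
        (cong₂ _+_ (delay-cong w (total-bridge-up x (2 + k)) N)
          (delay-cong w (λ i → trans (total-cong x (bridge-suc k 0) i) (total-bridge-up x k i)) N)))
    where w = stepWeight x

  total-bridge-down : ∀ x k → total x (bridge 0 k) ≗ endCount x k
  total-bridge-down x       zero    N       = total-bridge-up x 0 N
  total-bridge-down zero    (suc k) zero    = refl
  total-bridge-down zero    (suc k) (suc N) = refl
  total-bridge-down (suc x) (suc k) N =
    trans (total-suc x (bridge 0 (suc k)) N)
      (cong₂ _+_
        (cong₂ _+_ (total-bridge-down x (suc k) N) (delay-cong (w + w) (total-bridge-down x (suc k)) N))
        (trans (+-comm (delay₀ w (total x (bridge 1 (suc k))) N) _)
        (cong₂ _+_ (delay-cong w (total-bridge-down x (2 + k)) N)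
          (delay-cong w (λ i → trans (total-cong x (bridge-suc 0 k) i) (total-bridge-down x k i)) N))))
    where w = stepWeight x

-- Allows `walkTotal` to be restricted to the words of displacement 0, the ones that correspond to
-- partitions.
walkValue-bridge : ∀ {x} h m (w : Word x) → bridge h 0 w ≡ 0 → walkValue h m w ≡ 0
walkValue-bridge zero          m []          ()
walkValue-bridge (suc h)       m []          eq = refl
walkValue-bridge h             m (level ∷ w) eq = walkValue-bridge h m w eq
walkValue-bridge h             m (both ∷ w)  eq = walkValue-bridge h m w eq
walkValue-bridge h             m (up ∷ w)    eq = walkValue-bridge (suc h) m w eq
walkValue-bridge zero          m (down ∷ w)  eq = refl
walkValue-bridge (suc zero)    zero    (down ∷ w) eq =
  walkValue-bridge 0 0 w (trans (sym (bridge-suc 0 0 w)) eq)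
walkValue-bridge (suc zero)    (suc m) (down ∷ w) eq =
  cong₂ _+_ (walkValue-bridge 0 (suc m) w (trans (sym (bridge-suc 0 0 w)) eq))
            (walkValue-bridge 0 m w (trans (sym (bridge-suc 0 0 w)) eq))
walkValue-bridge (suc (suc h)) m (down ∷ w)  eq =
  walkValue-bridge (suc h) m w (trans (sym (bridge-suc (suc h) 0 w)) eq)

-- A strictly decreasing list of numbers below x, presented as one decision for each of x - 1, ...,
-- 0. Two such derivations of the same x are exactly a word.
data Descending : ℕ → List ℕ → Set where
  []   : Descending zero []
  skip : ∀ {x as} → Descending x as → Descending (suc x) as
  take : ∀ {x as} → Descending x as → Descending (suc x) (x ∷ as)

descending-< : ∀ {x a as} → Descending x (a ∷ as) → a < x
descending-< (skip d) = m<n⇒m<1+n (descending-< d)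
descending-< (take d) = ≤-refl

encode : ∀ {x as bs} → Descending x as → Descending x bs → Word x
encode []       []       = []
encode (skip d) (skip e) = level ∷ encode d e
encode (take d) (take e) = both ∷ encode d e
encode (take d) (skip e) = up ∷ encode d e
encode (skip d) (take e) = down ∷ encode d e

upper lower : ∀ {x} → Word x → List ℕ
upper []                    = []
upper {suc x} ((t , _) ∷ w) = if t then x ∷ upper w else upper w
lower []                    = []
lower {suc x} ((_ , t) ∷ w) = if t then x ∷ lower w else lower w

upper-encode : ∀ {x as bs} (d : Descending x as) (e : Descending x bs) → upper (encode d e) ≡ as
upper-encode []       []       = refl
upper-encode (skip d) (skip e) = upper-encode d e
upper-encode (take d) (take e) = cong (_ ∷_) (upper-encode d e)
upper-encode (take d) (skip e) = cong (_ ∷_) (upper-encode d e)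
upper-encode (skip d) (take e) = upper-encode d e

lower-encode : ∀ {x as bs} (d : Descending x as) (e : Descending x bs) → lower (encode d e) ≡ bs
lower-encode []       []       = refl
lower-encode (skip d) (skip e) = lower-encode d e
lower-encode (take d) (take e) = cong (_ ∷_) (lower-encode d e)
lower-encode (take d) (skip e) = lower-encode d e
lower-encode (skip d) (take e) = cong (_ ∷_) (lower-encode d e)

weight : List ℕ → ℕ
weight as = sum (map stepWeight as)

private
  delay-reach : {A : Set} {z : A} → ∀ c f N M → c + M ≡ N → delay z c f N ≡ f M
  delay-reach c f .(c + M) M refl = delay-shift c f M

∈-words : ∀ {x as bs} (d : Descending x as) (e : Descending x bs) →
          encode d e ∈ words x (weight as + weight bs)
∈-words []       []       = here refl
∈-words (skip d) (skip e) = ∈-++⁺ˡ (∈-++⁺ˡ (∈-map⁺ (level ∷_) (∈-words d e)))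
∈-words {suc x} {_ ∷ as} {_ ∷ bs} (take d) (take e) =
  ∈-++⁺ˡ (∈-++⁺ʳ (map (level ∷_) (words x _)) (∈-map⁺ (both ∷_)
    (subst (encode d e ∈_)
      (sym (delay-reach (stepWeight x + stepWeight x) (words x) _ _
             (interchange (stepWeight x) (stepWeight x) (weight as) (weight bs))))
      (∈-words d e))))
∈-words {suc x} {_ ∷ as} {bs} (take d) (skip e) =
  ∈-++⁺ʳ (map (level ∷_) (words x _) ++ _) (∈-++⁺ˡ (∈-map⁺ (up ∷_)
    (subst (encode d e ∈_)
      (sym (delay-reach (stepWeight x) (words x) _ _
             (sym (+-assoc (stepWeight x) (weight as) (weight bs)))))
      (∈-words d e))))
∈-words {suc x} {as} {.x ∷ bs} (skip d) (take e) =
  ∈-++⁺ʳ (map (level ∷_) (words x _) ++ _) (∈-++⁺ʳ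
    (map (up ∷_) (delay [] (stepWeight x) (words x) (weight as + weight (x ∷ bs))))
    (∈-map⁺ (down ∷_)
    (subst (encode d e ∈_)
      (sym (delay-reach (stepWeight x) (words x) _ _
             (swap (stepWeight x) (weight as) (weight bs))))
      (∈-words d e))))
  where
  swap : ∀ a b c → a + (b + c) ≡ b + (a + c)
  swap = solve-∀

encode-bridge : ∀ {x as bs} u v (d : Descending x as) (e : Descending x bs) →
  u + length as ≡ v + length bs → bridge u v (encode d e) ≡ 1
encode-bridge u v [] [] eq =
  trans (cong (agree u) (trans (sym (+-identityʳ v)) (trans (sym eq) (+-identityʳ u)))) (agree-refl u)
encode-bridge u v (skip d) (skip e) eq = encode-bridge u v d e eq
encode-bridge {as = _ ∷ as} {_ ∷ bs} u v (take d) (take e) eq =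
  encode-bridge u v d e
    (suc-injective (trans (sym (+-suc u (length as))) (trans eq (+-suc v (length bs)))))
encode-bridge {as = _ ∷ as} {bs} u v (take d) (skip e) eq =
  encode-bridge (suc u) v d e (trans (sym (+-suc u (length as))) eq)
encode-bridge {as = as} {_ ∷ bs} u v (skip d) (take e) eq =
  encode-bridge u (suc v) d e (trans eq (+-suc v (length bs)))

HeadBelow : ℕ → List ℕ → Set
HeadBelow b as = All (_< b) (Data.List.take 1 as)

headBelow? : ∀ b as → Dec (HeadBelow b as)
headBelow? b as = All.all? (_<? b) (Data.List.take 1 as)

-- pairValue m as bs is binom(r, m) if as dominates bs entrywise, where r
-- counts the indices i with b_i < a_i and, unless i is the last index,
-- a_{i+1} < b_i; otherwise it is 0.
mutual
  pairValue : ℕ → List ℕ → List ℕ → ℕ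
  pairValue zero    []       []       = 1
  pairValue (suc _) []       []       = 0
  pairValue m       []       (_ ∷ _)  = 0
  pairValue m       (_ ∷ _)  []       = 0
  pairValue m       (a ∷ as) (b ∷ bs) =
    if does (a <? b) then 0
    else if does ((b <? a) ×-dec headBelow? b as) then landValue m as bs
    else pairValue m as bs

  landValue : ℕ → List ℕ → List ℕ → ℕ
  landValue zero    as bs = pairValue zero as bs
  landValue (suc m) as bs = pairValue (suc m) as bs + pairValue m as bs

pairValue-< : ∀ m {a as b bs} → a < b → pairValue m (a ∷ as) (b ∷ bs) ≡ 0
pairValue-< zero    {a} {as} {b} a<b rewrite dec-true (a <? b) a<b = refl
pairValue-< (suc m) {a} {as} {b} a<b rewrite dec-true (a <? b) a<b = refl

pairValue-land : ∀ m {a as b bs} → b < a → HeadBelow b as →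
  pairValue m (a ∷ as) (b ∷ bs) ≡ landValue m as bs
pairValue-land zero {a} {as} {b} b<a below
  rewrite dec-false (a <? b) (<-asym b<a)
        | dec-true ((b <? a) ×-dec headBelow? b as) (b<a , below) = refl
pairValue-land (suc m) {a} {as} {b} b<a below
  rewrite dec-false (a <? b) (<-asym b<a)
        | dec-true ((b <? a) ×-dec headBelow? b as) (b<a , below) = refl

pairValue-pass : ∀ m {a as b bs} → b ≤ a → ¬ (b < a × HeadBelow b as) →
  pairValue m (a ∷ as) (b ∷ bs) ≡ pairValue m as bs
pairValue-pass zero {a} {as} {b} b≤a stays
  rewrite dec-false (a <? b) (≤⇒≯ b≤a)
        | dec-false ((b <? a) ×-dec headBelow? b as) stays = refl
pairValue-pass (suc m) {a} {as} {b} b≤a stays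
  rewrite dec-false (a <? b) (≤⇒≯ b≤a)
        | dec-false ((b <? a) ×-dec headBelow? b as) stays = refl

-- ps holds the entries of A that the walk has met but not yet matched with
-- entries of B.
encode-walkValue : ∀ {x as bs} m ps → All (x ≤_) ps →
  (d : Descending x as) (e : Descending x bs) →
  walkValue (length ps) m (encode d e) ≡ pairValue m (ps ++ as) bs
encode-walkValue zero    []       _  [] [] = refl
encode-walkValue (suc m) []       _  [] [] = refl
encode-walkValue zero    (p ∷ ps) _  [] [] = refl
encode-walkValue (suc m) (p ∷ ps) _  [] [] = refl
encode-walkValue m ps x<ps (skip d) (skip e) =
  encode-walkValue m ps (All.map <⇒≤ x<ps) d e
encode-walkValue {suc x} {_ ∷ as} {bs} m ps x<ps (take d) (skip e) = begin
  walkValue (suc (length ps)) m (encode d e)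
    ≡⟨ cong (λ h → walkValue h m (encode d e)) (trans (+-comm 1 (length ps)) (sym (List.length-++ ps))) ⟩
  walkValue (length (ps ++ x ∷ [])) m (encode d e)
    ≡⟨ encode-walkValue m (ps ++ x ∷ []) (++⁺ (All.map <⇒≤ x<ps) (≤-refl ∷ [])) d e ⟩
  pairValue m ((ps ++ x ∷ []) ++ as) bs
    ≡⟨ cong (λ z → pairValue m z bs) (List.++-assoc ps (x ∷ []) as) ⟩
  pairValue m (ps ++ x ∷ as) bs ∎
encode-walkValue {suc x} {_ ∷ as} {_ ∷ bs} m [] _ (take d) (take e) =
  trans (encode-walkValue m [] [] d e)
        (sym (pairValue-pass m {x} {as} {x} {bs} ≤-refl (λ (x<x , _) → <-irrefl refl x<x)))
-- The pending entries form a queue: `x` from B is matched with the oldest one, `p`, and `x` from A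
-- joins at the end. The entry of A after `p` is then at least `x`, so this index is not counted.
encode-walkValue {suc x} {_ ∷ as} {_ ∷ bs} m (p ∷ ps) (x<p ∷ x<ps) (take d) (take e) = begin
  walkValue (suc (length ps)) m (encode d e)
    ≡⟨ cong (λ h → walkValue h m (encode d e)) (trans (+-comm 1 (length ps)) (sym (List.length-++ ps))) ⟩
  walkValue (length (ps ++ x ∷ [])) m (encode d e)
    ≡⟨ encode-walkValue m (ps ++ x ∷ []) (++⁺ (All.map <⇒≤ x<ps) (≤-refl ∷ [])) d e ⟩
  pairValue m ((ps ++ x ∷ []) ++ as) bs
    ≡⟨ cong (λ z → pairValue m z bs) (List.++-assoc ps (x ∷ []) as) ⟩
  pairValue m (ps ++ x ∷ as) bs
    ≡⟨ pairValue-pass m (<⇒≤ x<p) (stays x<ps) ⟨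
  pairValue m (p ∷ ps ++ x ∷ as) (x ∷ bs) ∎
  where
  stays : ∀ {ps} → All (x <_) ps → ¬ (x < p × HeadBelow x (ps ++ x ∷ as))
  stays []        (_ , x<x ∷ []) = <-irrefl refl x<x
  stays (x<p ∷ _) (_ , p<x ∷ []) = <-asym x<p p<x
encode-walkValue {suc x} {[]}     {_ ∷ bs} zero    [] _ (skip d) (take e) = refl
encode-walkValue {suc x} {[]}     {_ ∷ bs} (suc m) [] _ (skip d) (take e) = refl
encode-walkValue {suc x} {_ ∷ as} {_ ∷ bs} m [] _ (skip d) (take e) =
  sym (pairValue-< m (descending-< d))
-- A single pending entry means height 1. All later entries of A lie below `x`, so the step from 1
-- to 0 is exactly a counted index.
encode-walkValue {suc x} {as} {_ ∷ bs} m (p ∷ []) (x<p ∷ []) (skip d) (take e) =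
  trans (landing m) (sym (pairValue-land m x<p (below d)))
  where
  below : ∀ {as} → Descending x as → HeadBelow x as
  below {[]}     _ = []
  below {_ ∷ _} d = descending-< d ∷ []
  landing : ∀ m → walkValue 1 m (down ∷ encode d e) ≡ landValue m as bs
  landing zero    = encode-walkValue zero [] [] d e
  landing (suc m) = cong₂ _+_ (encode-walkValue (suc m) [] [] d e) (encode-walkValue m [] [] d e)
-- The next entry of A is `q`, still pending and above `x`: the walk stays positive and the index is
-- not counted.
encode-walkValue {suc x} {as} {_ ∷ bs} m (p ∷ q ∷ ps) (x<p ∷ x<ps) (skip d) (take e) =
  trans (encode-walkValue m (q ∷ ps) (All.map <⇒≤ x<ps) d e)
        (sym (pairValue-pass m (<⇒≤ x<p) (λ { (_ , q<x ∷ []) → <-asym q<x (All.head x<ps) })))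

-- Rows, columns and Frobenius coordinates

Decreasing : List ℕ → Set
Decreasing = Linked _≥_

column : List ℕ → ℕ → ℕ
column π j = length (filter (j <?_) π)

row-≤-head : ∀ {x π} → Decreasing (x ∷ π) → ∀ i → row π i ≤ x
row-≤-head [-]        i       = z≤n
row-≤-head (x≥y ∷ _)  zero    = x≥y
row-≤-head (x≥y ∷ dec) (suc i) = ≤-trans (row-≤-head dec i) x≥y

row-antitone : ∀ {π} → Decreasing π → ∀ {i j} → i ≤ j → row π j ≤ row π i
row-antitone {[]}    _   _              = z≤n
row-antitone {x ∷ π} _   {zero} {zero}  _ = ≤-refl
row-antitone {x ∷ π} dec {zero} {suc j} _ = row-≤-head dec j
row-antitone {x ∷ π} dec (s≤s i≤j)      = row-antitone (Linked.tail dec) i≤j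

column-empty : ∀ {π j} → Decreasing π → row π 0 ≤ j → column π j ≡ 0
column-empty {[]}    dec _ = refl
column-empty {x ∷ π} {j} dec x≤j
  rewrite List.filter-reject (j <?_) {x} {π} (≤⇒≯ x≤j) =
  column-empty (Linked.tail dec) (≤-trans (row-≤-head dec 0) x≤j)

column-∷ : ∀ {x j} π → j < x → column (x ∷ π) j ≡ suc (column π j)
column-∷ {x} {j} π j<x = cong length (List.filter-accept (j <?_) {x} {π} j<x)

row⇒column : ∀ {π} → Decreasing π → ∀ {i j} → j < row π i → i < column π j
row⇒column {x ∷ π} dec {i} j<row
  rewrite column-∷ π (<-≤-trans j<row (row-antitone dec {0} {i} z≤n)) with i
... | zero   = s≤s z≤n
... | suc i′ = s≤s (row⇒column (Linked.tail dec) j<row)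

column⇒row : ∀ {π} → Decreasing π → ∀ {i j} → i < column π j → j < row π i
column⇒row {x ∷ π} dec {i} {j} i<col with j <? x
... | no j≮x = contradiction (subst (i <_) (column-empty dec (≮⇒≥ j≮x)) i<col) λ ()
... | yes j<x = go i (subst (i <_) (column-∷ π j<x) i<col)
  where
  go : ∀ i → i < suc (column π j) → j < row (x ∷ π) i
  go zero    _     = j<x
  go (suc i) i<col = column⇒row (Linked.tail dec) (s≤s⁻¹ i<col)

column-antitone : ∀ {π} → Decreasing π → ∀ {i j} → i ≤ j → column π j ≤ column π i
column-antitone dec i≤j =
  ≮⇒≥ λ lt → <-irrefl refl (row⇒column dec (≤-<-trans i≤j (column⇒row dec lt)))

row-conjugate : ∀ {π} → Decreasing π → ∀ j → row (conjugate π) j ≡ column π j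
row-conjugate {π} dec j with j <? row π 0
... | yes j<row = go (column π) j<row
  where
  go : ∀ (f : ℕ → ℕ) {j n} → j < n → row (applyUpTo f n) j ≡ f j
  go f {zero}  {suc n} _         = refl
  go f {suc j} {suc n} (s≤s j<n) = go (f ∘ suc) j<n
... | no j≮row = trans (go (column π) (≮⇒≥ j≮row)) (sym (column-empty dec (≮⇒≥ j≮row)))
  where
  go : ∀ (f : ℕ → ℕ) {j n} → n ≤ j → row (applyUpTo f n) j ≡ 0
  go f {j}     {zero}  _         = refl
  go f {suc j} {suc n} (s≤s n≤j) = go (f ∘ suc) n≤j

row-positive⇒<length : ∀ π {i} → 0 < row π i → i < length π
row-positive⇒<length (x ∷ π) {zero}  _   = s≤s z≤n
row-positive⇒<length (x ∷ π) {suc i} pos = s≤s (row-positive⇒<length π pos)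

durfee-square : ∀ π → SquareIn π (durfee π)
durfee-square π = go (argmax-sel id 0 squares)
  where
  squares : List ℕ
  squares = filter (squareIn? π) (upTo (suc (length π)))
  go : durfee π ≡ 0 ⊎ durfee π ∈ squares → SquareIn π (durfee π)
  go (inj₁ d≡0) i<d = contradiction (subst (_ <_) d≡0 i<d) λ ()
  go (inj₂ d∈)  = proj₂ (∈-filter⁻ (squareIn? π) {xs = upTo (suc (length π))} d∈)

squareIn-≤-durfee : ∀ π {k} → SquareIn π k → k ≤ durfee π
squareIn-≤-durfee π {zero}  _      = z≤n
squareIn-≤-durfee π {suc k} square =
  v≤max⁺ 0 (filter (squareIn? π) (upTo (suc (length π)))) (inj₂ (lose
    (∈-filter⁺ (squareIn? π)
      (∈-applyUpTo⁺ id (s≤s (row-positive⇒<length π (≤-<-trans z≤n (square ≤-refl ≤-refl)))))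
      square)
    ≤-refl))

<durfee⇒<row : ∀ π {i} → i < durfee π → i < row π i
<durfee⇒<row π i<d = durfee-square π i<d i<d

<row⇒<durfee : ∀ {π} → Decreasing π → ∀ {i} → i < row π i → i < durfee π
<row⇒<durfee {π} dec i<row =
  squareIn-≤-durfee π (λ i′≤i j≤i → <-≤-trans (≤-<-trans (s≤s⁻¹ j≤i) i<row) (row-antitone dec (s≤s⁻¹ i′≤i)))

<durfee⇒<column : ∀ {π} → Decreasing π → ∀ {i} → i < durfee π → i < column π i
<durfee⇒<column {π} dec i<d = row⇒column dec (<durfee⇒<row π i<d)

-- The Frobenius coordinates of π, meaningful for i < durfee π only.
arm leg : List ℕ → ℕ → ℕ
arm π i = row π i ∸ suc i
leg π i = column π i ∸ suc i

segment : {A : Set} → (ℕ → A) → ℕ → ℕ → List A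
segment f i zero    = []
segment f i (suc k) = f i ∷ segment f (suc i) k

arms legs : List ℕ → List ℕ
arms π = segment (arm π) 0 (durfee π)
legs π = segment (leg π) 0 (durfee π)

row-map-pred : ∀ π i → row (map pred π) i ≡ pred (row π i)
row-map-pred []      i       = refl
row-map-pred (x ∷ π) zero    = refl
row-map-pred (x ∷ π) (suc i) = row-map-pred π i

column-map-pred : ∀ π j → column (map pred π) j ≡ column π (suc j)
column-map-pred []      j = refl
column-map-pred (x ∷ π) j with suc j <? x
... | yes j<x = trans (column-∷ (map pred π) (pred-mono-≤ j<x))
                (trans (cong suc (column-map-pred π j)) (sym (column-∷ π j<x)))
... | no  j≮x = begin
  column (pred x ∷ map pred π) j
    ≡⟨ cong length (List.filter-reject (j <?_) (j≮x ∘ lift x)) ⟩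
  column (map pred π) j
    ≡⟨ column-map-pred π j ⟩
  column π (suc j)
    ≡⟨ cong length (List.filter-reject (suc j <?_) j≮x) ⟨
  column (x ∷ π) (suc j) ∎
  where
  lift : ∀ x → j < pred x → suc j < x
  lift (suc x) = s≤s

sum-map-pred : ∀ π → sum π ≡ column π 0 + sum (map pred π)
sum-map-pred []          = refl
sum-map-pred (zero ∷ π)  = sum-map-pred π
sum-map-pred (suc x ∷ π) = cong suc (trans (cong (x +_) (sum-map-pred π)) (swap x (column π 0) _))
  where
  swap : ∀ a b c → a + (b + c) ≡ b + (a + c)
  swap = solve-∀

decreasing-map-pred : ∀ {π} → Decreasing π → Decreasing (map pred π)
decreasing-map-pred []          = []
decreasing-map-pred [-]         = [-]
decreasing-map-pred (x≥y ∷ dec) = pred-mono-≤ x≥y ∷ decreasing-map-pred dec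

hookSum : List ℕ → ℕ → ℕ
hookSum π d = sum (segment (λ i → suc (arm π i + leg π i)) 0 d)

segment-cong-suc : {A : Set} {f g : ℕ → A} → ∀ i k → (∀ {t} → t < i + k → f (suc t) ≡ g t) →
                   segment f (suc i) k ≡ segment g i k
segment-cong-suc i zero    eq = refl
segment-cong-suc i (suc k) eq =
  cong₂ _∷_ (eq (m<m+n i (s≤s z≤n)))
            (segment-cong-suc (suc i) k (λ {t} t< → eq (subst (t <_) (sym (+-suc i k)) t<)))

-- The induction on d removes the first row and the first column.
sum-hooks : ∀ d {π} → Decreasing π → (∀ {i} → i < d → i < row π i) → row π d ≤ d →
            sum π ≡ hookSum π d
sum-hooks zero {[]}    dec _ _   = refl
sum-hooks zero {x ∷ π} dec _ x≤0 = empty dec x≤0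
  where
  empty : ∀ {x π} → Decreasing (x ∷ π) → x ≤ 0 → sum (x ∷ π) ≡ 0
  empty [-]          z≤n = refl
  empty (z≤n ∷ dec) z≤n = empty dec z≤n
sum-hooks (suc d) {[]} dec inside _ = contradiction (inside (s≤s z≤n)) λ ()
sum-hooks (suc d) {zero ∷ π} dec inside _ = contradiction (inside (s≤s z≤n)) λ ()
sum-hooks (suc d) {suc x ∷ π} dec inside outside =
  cong suc (begin
    x + sum π
      ≡⟨ cong (x +_) (sum-map-pred π) ⟩
    x + (column π 0 + sum ρ)
      ≡⟨ +-assoc x (column π 0) (sum ρ) ⟨
    x + column π 0 + sum ρ
      ≡⟨ cong (x + column π 0 +_)
              (sum-hooks d (decreasing-map-pred (Linked.tail dec)) inside′ outside′) ⟩
    x + column π 0 + hookSum ρ d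
      ≡⟨ cong (λ z → x + column π 0 + sum z) (segment-cong-suc 0 d same) ⟨
    x + column π 0 + sum (segment (λ i → suc (arm (suc x ∷ π) i + leg (suc x ∷ π) i)) 1 d) ∎)
  where
  -- Removing the first column may leave parts 0, so the induction runs over weakly decreasing lists
  -- and not over partitions proper.
  ρ : List ℕ
  ρ = map pred π
  inside′ : ∀ {i} → i < d → i < row ρ i
  inside′ {i} i<d = subst (i <_) (sym (row-map-pred π i)) (pred-mono-≤ (inside (s≤s i<d)))
  outside′ : row ρ d ≤ d
  outside′ = subst (_≤ d) (sym (row-map-pred π d)) (pred-mono-≤ outside)
  ∸-pred : ∀ a b → a ∸ suc b ≡ pred a ∸ b
  ∸-pred zero    zero    = refl
  ∸-pred zero    (suc b) = refl
  ∸-pred (suc a) b       = refl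
  same : ∀ {t} → t < d →
    suc (arm (suc x ∷ π) (suc t) + leg (suc x ∷ π) (suc t)) ≡ suc (arm ρ t + leg ρ t)
  same {t} t<d = cong suc (cong₂ _+_
    (trans (∸-pred (row π t) (suc t)) (cong (_∸ suc t) (sym (row-map-pred π t))))
    (begin
      column (suc x ∷ π) (suc t) ∸ suc (suc t)
        ≡⟨ cong (λ z → length z ∸ suc (suc t))
                (List.filter-accept (suc t <?_) {suc x} {π} t<x) ⟩
      column π (suc t) ∸ suc t
        ≡⟨ cong (_∸ suc t) (column-map-pred π t) ⟨
      column ρ t ∸ suc t ∎))
    where
    t<x : suc t < suc x
    t<x = <-≤-trans (inside (s≤s t<d)) (row-≤-head dec t)

-- Counting blocks row by row

-- Rows enter from the bottom up, and the cells of a row from right to left. A new cell can then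
-- touch only the block of its right neighbour and the block of the cell below, which stand at the
-- front of the list; this and the next two lemmas cover the resulting cases.
components-new : ∀ {c} cs → All (¬_ ∘ Touches c) (components cs) →
                 components (c ∷ cs) ≡ (c ∷ []) ∷ components cs
components-new {c} cs apart =
  cong₂ (λ ts us → (c ∷ concat ts) ∷ us)
    (List.filter-none (touches? c) apart)
    (List.filter-all (¬? ∘ touches? c) apart)

components-extend : ∀ {c B bs} cs → components cs ≡ B ∷ bs → Touches c B →
  All (¬_ ∘ Touches c) bs → components (c ∷ cs) ≡ (c ∷ B) ∷ bs
components-extend {c} {B} {bs} cs eq touch apart rewrite eq =
  cong₂ (λ ts us → (c ∷ ts) ∷ us)
    (trans (cong concat (trans (List.filter-accept (touches? c) {B} {bs} touch)
                               (cong (B ∷_) (List.filter-none (touches? c) apart))))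
           (List.++-identityʳ B))
    (trans (List.filter-reject (¬? ∘ touches? c) {B} {bs} (λ ¬t → ¬t touch))
           (List.filter-all (¬? ∘ touches? c) apart))

components-merge : ∀ {c A B bs} cs → components cs ≡ A ∷ B ∷ bs →
  Touches c A → Touches c B → All (¬_ ∘ Touches c) bs →
  components (c ∷ cs) ≡ (c ∷ A ++ B) ∷ bs
components-merge {c} {A} {B} {bs} cs eq touchA touchB apart rewrite eq =
  cong₂ (λ ts us → (c ∷ ts) ∷ us)
    (trans (cong concat
             (trans (List.filter-accept (touches? c) {A} {B ∷ bs} touchA)
             (cong (A ∷_) (trans (List.filter-accept (touches? c) {B} {bs} touchB)
                                 (cong (B ∷_) (List.filter-none (touches? c) apart))))))
           (cong (A ++_) (List.++-identityʳ B)))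
    (trans (List.filter-reject (¬? ∘ touches? c) {A} {B ∷ bs} (λ ¬t → ¬t touchA))
    (trans (List.filter-reject (¬? ∘ touches? c) {B} {bs} (λ ¬t → ¬t touchB))
           (List.filter-all (¬? ∘ touches? c) apart)))

private
  adjacent-right : ∀ i j → Adjacent (i , j) (i , suc j)
  adjacent-right i j = inj₁ (refl , trans (cong (∣ j -_∣) (+-comm 1 j)) (∣m-m+n∣≡n j 1))

  adjacent-below : ∀ i j → Adjacent (i , j) (suc i , j)
  adjacent-below i j = inj₂ (refl , trans (cong (∣ i -_∣) (+-comm 1 i)) (∣m-m+n∣≡n i 1))

  adjacent-row-≤ : ∀ {i j i′ j′} → Adjacent (i , j) (i′ , j′) → i′ ≤ suc i
  adjacent-row-≤ {i} (inj₁ (refl , _)) = n≤1+n i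
  adjacent-row-≤ {i} {i′ = i′} (inj₂ (_ , d≡1)) =
    ≤-trans (m≤n+∣m-n∣ i′ i)
            (≤-reflexive (trans (cong (i +_) (trans (∣-∣-comm i′ i) d≡1)) (+-comm i 1)))

  adjacent-below⁻ : ∀ {i j j′} → Adjacent (i , j) (suc i , j′) → j ≡ j′
  adjacent-below⁻ {i} (inj₁ (i≡1+i , _)) = contradiction (sym i≡1+i) 1+n≢n
  adjacent-below⁻     (inj₂ (eq , _))    = eq

cellRun : ℕ → ℕ → ℕ → List Cell
cellRun i = segment (i ,_)

components-run : ∀ i j n cs →
  (∀ {t} → j ≤ t → All (¬_ ∘ Touches (i , t)) (components cs)) →
  components (cellRun i j (suc n) ++ cs) ≡ cellRun i j (suc n) ∷ components cs
components-run i j zero    cs apart = components-new cs (apart ≤-refl)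
components-run i j (suc n) cs apart =
  components-extend (cellRun i (suc j) (suc n) ++ cs)
    (components-run i (suc j) n cs (λ 1+j≤t → apart (<⇒≤ 1+j≤t)))
    (here (adjacent-right i j)) (apart ≤-refl)

-- Row i of the diagram consists of the columns from lo i to hi i - 1.
module Blocks (lo hi : ℕ → ℕ)
  (lo-antitone : ∀ i → lo (suc i) ≤ lo i) (hi-antitone : ∀ i → hi (suc i) ≤ hi i) where

  rowCells : ℕ → List Cell
  rowCells i = cellRun i (lo i) (hi i ∸ lo i)

  rowsCells : ℕ → ℕ → List Cell
  rowsCells i zero    = []
  rowsCells i (suc k) = rowCells i ++ rowsCells (suc i) k

  -- Row i is nonempty and is not joined to row i + 1.
  Last : ℕ → Set
  Last i = lo i < hi i × hi (suc i) ≤ lo i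

  last? : Decidable Last
  last? i = (lo i <? hi i) ×-dec (hi (suc i) ≤? lo i)

  private
    From : ℕ → Cell → Set
    From i (i′ , j) = i < i′ ⊎ (i′ ≡ i × j < hi i)

    from-suc : ∀ {i c} → From (suc i) c → From i c
    from-suc (inj₁ 1+i<i′)      = inj₁ (<⇒≤ 1+i<i′)
    from-suc (inj₂ (refl , _))  = inj₁ ≤-refl

    -- The invariant under which row i - 1 can be added: its cells reach no further down than row i,
    -- which by `headed` lies entirely in the first block, so no other block can change. `from`
    -- bounds row i on the right, which keeps cells beyond its end apart from it.
    record Shape (i : ℕ) (bs : List (List Cell)) : Set where
      field
        from   : All (All (From i)) bs
        headed : lo i < hi i →
          Σ[ B ∈ List Cell ] Σ[ rest ∈ List (List Cell) ] bs ≡ B ∷ rest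
            × (∀ {t} → lo i ≤ t → t < hi i → (i , t) ∈ B)
            × All (All (λ c → i < proj₁ c)) rest

    apart-right : ∀ {i t bs} → All (All (From (suc i))) bs → hi (suc i) ≤ t →
                  All (¬_ ∘ Touches (i , t)) bs
    apart-right {i} {t} fs hi≤t = All.map (λ f touch → go f (find touch)) fs
      where
      go : ∀ {b} → All (From (suc i)) b → ¬ (Σ[ c ∈ Cell ] c ∈ b × Adjacent (i , t) c)
      go f (c , c∈b , adj) with All.lookup f c∈b
      ... | inj₁ 1+i<i′       = <-irrefl refl (<-≤-trans 1+i<i′ (adjacent-row-≤ adj))
      ... | inj₂ (refl , j<hi) =
        <-irrefl (sym (adjacent-below⁻ adj)) (<-≤-trans j<hi hi≤t)

    apart-below : ∀ {i t bs} → All (All (λ c → suc i < proj₁ c)) bs →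
                  All (¬_ ∘ Touches (i , t)) bs
    apart-below {i} {t} fs = All.map (λ f touch → go f (find touch)) fs
      where
      go : ∀ {b} → All (λ c → suc i < proj₁ c) b → ¬ (Σ[ c ∈ Cell ] c ∈ b × Adjacent (i , t) c)
      go f (c , c∈b , adj) =
        <-irrefl refl (<-≤-trans (All.lookup f c∈b) (adjacent-row-≤ adj))

    cellRun-from : ∀ i j n → j + n ≤ hi i → All (From i) (cellRun i j n)
    cellRun-from i j zero    _  = []
    cellRun-from i j (suc n) le =
      inj₂ (refl , ≤-trans (m<m+n j (s≤s z≤n)) le)
      ∷ cellRun-from i (suc j) n (subst (_≤ hi i) (+-suc j n) le)

    ∈-cellRun : ∀ i j n {t} → j ≤ t → t < j + n → (i , t) ∈ cellRun i j n
    ∈-cellRun i j zero    {t} j≤t t<j = contradiction (subst (t <_) (+-identityʳ j) t<j) (≤⇒≯ j≤t)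
    ∈-cellRun i j (suc n) {t} j≤t t<j with m≤n⇒m<n∨m≡n j≤t
    ... | inj₁ j<t  = there (∈-cellRun i (suc j) n j<t (subst (t <_) (+-suc j n) t<j))
    ... | inj₂ refl = here refl

    shape-empty : ∀ {i bs} → hi i ≤ lo i → All (All (From (suc i))) bs → Shape i bs
    shape-empty hi≤lo fs = record
      { from   = All.map (All.map from-suc) fs
      ; headed = λ lo<hi → contradiction hi≤lo (<⇒≱ lo<hi) }

    shape-cons : ∀ {i B bs} → All (From i) B → All (All (λ c → i < proj₁ c)) bs →
      (∀ {t} → lo i ≤ t → t < hi i → (i , t) ∈ B) → Shape i (B ∷ bs)
    shape-cons fB below row = record
      { from   = fB ∷ All.map (All.map inj₁) below
      ; headed = λ _ → _ , _ , refl , row , below }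

    from-suc-below : ∀ {i bs} → All (All (From (suc i))) bs → All (All (λ c → i < proj₁ c)) bs
    from-suc-below = All.map (All.map λ { (inj₁ lt) → <⇒≤ lt ; (inj₂ (refl , _)) → ≤-refl })

    -- The cells of row i in the columns from j on, where j lies under the
    -- upper end u of row i + 1: they all join the block B of row i + 1.
    components-join : ∀ i u e cs {B rest} → hi (suc i) ≡ suc u → hi i ≡ suc u + e →
      components cs ≡ B ∷ rest →
      All (All (From (suc i))) (B ∷ rest) → All (All (λ c → suc i < proj₁ c)) rest →
      ∀ n j → j + n ≡ u → (∀ {t} → j ≤ t → t ≤ u → (suc i , t) ∈ B) →
      Σ[ H ∈ List Cell ] components (cellRun i j (suc n + e) ++ cs) ≡ H ∷ rest
        × All (From i) H × (∀ {t} → j ≤ t → t < hi i → (i , t) ∈ H)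
    components-join i u zero cs {B} hi′≡ hi≡ eq (fB ∷ _) below zero j j≡ inB =
      (i , j) ∷ B ,
      components-extend cs eq (lose (inB ≤-refl j≤u) (adjacent-below i j)) (apart-below below) ,
      inj₂ (refl , subst (j <_) (sym hi≡′) (s≤s j≤u)) ∷ All.map from-suc fB ,
      λ j≤t t<hi → here (cong (i ,_) (≤-antisym
        (≤-trans (s≤s⁻¹ (subst (_ <_) hi≡′ t<hi)) (≤-reflexive (trans (sym j≡) (+-identityʳ j)))) j≤t))
      where
      j≤u : j ≤ u
      j≤u = ≤-trans (m≤m+n j 0) (≤-reflexive j≡)
      hi≡′ : hi i ≡ suc u
      hi≡′ = trans hi≡ (+-identityʳ (suc u))
    -- Nothing lies below the columns past u, so their cells form a block of their own until
    -- `(i , u)` merges it with `B`.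
    components-join i u (suc e) cs {B} {rest} hi′≡ hi≡ eq fs@(fB ∷ _) below zero j j≡ inB
      with refl ← trans (sym (+-identityʳ j)) j≡ =
      (i , u) ∷ run ++ B ,
      components-merge (run ++ cs) (trans (components-run i (suc u) e cs free) (cong (run ∷_) eq))
        (here (adjacent-right i u)) (lose (inB ≤-refl ≤-refl) (adjacent-below i u)) (apart-below below) ,
      inj₂ (refl , subst (u <_) (sym hi≡) (m≤m+n (suc u) (suc e)))
        ∷ ++⁺ (cellRun-from i (suc u) (suc e) (≤-reflexive (sym hi≡))) (All.map from-suc fB) ,
      λ u≤t t<hi → ∈-++⁺ˡ (∈-cellRun i u (2 + e) u≤t
        (subst (_ <_) (trans hi≡ (sym (+-suc u (suc e)))) t<hi))
      where
      run : List Cell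
      run = cellRun i (suc u) (suc e)
      free : ∀ {t} → suc u ≤ t → All (¬_ ∘ Touches (i , t)) (components cs)
      free u<t = subst (All _) (sym eq) (apart-right fs (subst (_≤ _) (sym hi′≡) u<t))
    components-join i u e cs hi′≡ hi≡ eq fs below (suc n) j j≡ inB =
      let H , eqH , fH , inH = components-join i u e cs hi′≡ hi≡ eq fs below n (suc j)
                                 (trans (sym (+-suc j n)) j≡) (λ {t} j<t → inB {t} (<⇒≤ j<t))
      in (i , j) ∷ H ,
         components-extend (cellRun i (suc j) (suc n + e) ++ cs) eqH
           (lose (inH ≤-refl (<-≤-trans 1+j≤u<hi ≤-refl)) (adjacent-right i j)) (apart-below below) ,
         inj₂ (refl , <-trans (n<1+n j) 1+j≤u<hi) ∷ fH ,
         λ j≤t t<hi → cell inH (m≤n⇒m<n∨m≡n j≤t) t<hi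
      where
      1+j≤u<hi : suc j < hi i
      1+j≤u<hi = ≤-trans (s≤s (≤-trans (m≤m+n (suc j) n) (≤-reflexive (trans (sym (+-suc j n)) j≡))))
                         (subst (suc u ≤_) (sym hi≡) (m≤m+n (suc u) e))
      cell : ∀ {H t} → (∀ {t} → suc j ≤ t → t < hi i → (i , t) ∈ H) →
             j < t ⊎ j ≡ t → t < hi i → (i , t) ∈ (i , j) ∷ H
      cell inH (inj₁ j<t)  t<hi = there (inH j<t t<hi)
      cell inH (inj₂ refl) t<hi = here refl

    rowCells-join : ∀ i u cs → Shape (suc i) (components cs) → hi (suc i) ≡ suc u → lo i ≤ u →
      Shape i (components (rowCells i ++ cs))
      × length (components (rowCells i ++ cs)) ≡ length (components cs)
    rowCells-join i u cs shape hi′≡ lo≤u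
      with B , rest , eq , inB , below ←
             Shape.headed shape (subst (lo (suc i) <_) (sym hi′≡) (s≤s (≤-trans (lo-antitone i) lo≤u))) =
      let H , eqH , fH , inH =
            components-join i u e cs hi′≡ hi≡ eq
              (subst (All (All (From (suc i)))) eq (Shape.from shape)) below n (lo i) n≡
              (λ lo≤t t≤u → inB (≤-trans (lo-antitone i) lo≤t)
                                (subst (_ <_) (sym hi′≡) (s≤s t≤u)))
          eqRow = trans (cong (λ k → components (cellRun i (lo i) k ++ cs)) size) eqH
      in subst (Shape i) (sym eqRow) (shape-cons fH (All.map (All.map <⇒≤) below) inH) ,
         trans (cong length eqRow) (sym (cong length eq))
      where
      n e : ℕ
      n = u ∸ lo i
      e = hi i ∸ suc u
      n≡ : lo i + n ≡ u
      n≡ = m+[n∸m]≡n lo≤u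
      hi≡ : hi i ≡ suc u + e
      hi≡ = sym (m+[n∸m]≡n (subst (_≤ hi i) hi′≡ (hi-antitone i)))
      size : hi i ∸ lo i ≡ suc n + e
      size = begin
        hi i ∸ lo i                 ≡⟨ cong (_∸ lo i) hi≡ ⟩
        suc u + e ∸ lo i            ≡⟨ cong (λ z → suc z + e ∸ lo i) n≡ ⟨
        suc (lo i + n) + e ∸ lo i   ≡⟨ cong (_∸ lo i) (trans (cong suc (+-assoc (lo i) n e))
                                                             (sym (+-suc (lo i) (n + e)))) ⟩
        lo i + suc (n + e) ∸ lo i   ≡⟨ m+n∸m≡n (lo i) (suc (n + e)) ⟩
        suc n + e ∎

    rowCells-new : ∀ i cs → Shape (suc i) (components cs) → Last i →
      Shape i (components (rowCells i ++ cs))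
      × length (components (rowCells i ++ cs)) ≡ suc (length (components cs))
    rowCells-new i cs shape (lo<hi , hi′≤lo) with hi i ∸ lo i | m+[n∸m]≡n (<⇒≤ lo<hi)
    ... | zero  | size = contradiction (trans (sym (+-identityʳ (lo i))) size) (<⇒≢ lo<hi)
    ... | suc n | size =
      subst (Shape i) (sym eq)
        (shape-cons (cellRun-from i (lo i) (suc n) (≤-reflexive size))
                    (from-suc-below (Shape.from shape))
                    (λ {t} lo≤t t<hi → ∈-cellRun i (lo i) (suc n) lo≤t (subst (t <_) (sym size) t<hi))) ,
      cong length eq
      where
      eq : components (cellRun i (lo i) (suc n) ++ cs) ≡ cellRun i (lo i) (suc n) ∷ components cs
      eq = components-run i (lo i) n cs
             (λ lo≤t → apart-right (Shape.from shape) (≤-trans hi′≤lo lo≤t))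

    -- A block occupies consecutive rows, and only its lowest row satisfies `Last`. Going up, a
    -- nonempty row either opens a block or joins that of the row beneath; `hi (i + k) ≡ 0` makes
    -- the lowest nonempty row open one.
    components-shape : ∀ i k → hi (i + k) ≡ 0 →
      Shape i (components (rowsCells i k))
      × length (components (rowsCells i k)) ≡ length (filter last? (segment id i k))
    components-shape i zero hi≡0 =
      shape-empty (≤-trans (≤-reflexive (trans (cong hi (sym (+-identityʳ i))) hi≡0)) z≤n) [] , refl
    components-shape i (suc k) hi≡0
      with components-shape (suc i) k (trans (cong hi (sym (+-suc i k))) hi≡0)
         | lo i <? hi i | hi (suc i) ≤? lo i
    ... | shape , count | no lo≮hi | _ rewrite m≤n⇒m∸n≡0 (≮⇒≥ lo≮hi) =
      shape-empty (≮⇒≥ lo≮hi) (Shape.from shape) ,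
      trans count (cong length (sym (List.filter-reject last? (lo≮hi ∘ proj₁))))
    ... | shape , count | yes lo<hi | yes hi′≤lo =
      let shape′ , count′ = rowCells-new i (rowsCells (suc i) k) shape (lo<hi , hi′≤lo)
      in shape′ , trans count′ (trans (cong suc count)
                    (cong length (sym (List.filter-accept last? (lo<hi , hi′≤lo)))))
    ... | shape , count | yes lo<hi | no hi′≰lo =
      let u , hi′≡ , lo≤u = split (≰⇒> hi′≰lo)
          shape′ , count′ = rowCells-join i u (rowsCells (suc i) k) shape hi′≡ lo≤u
      in shape′ , trans count′ (trans count
                    (cong length (sym (List.filter-reject last? (hi′≰lo ∘ proj₂)))))
      where
      split : ∀ {a b} → a < b → Σ[ u ∈ ℕ ] b ≡ suc u × a ≤ u
      split (s≤s a≤u) = _ , refl , a≤u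

  length-components : ∀ d → hi d ≡ 0 →
    length (components (rowsCells 0 d)) ≡ length (filter last? (segment id 0 d))
  length-components d hi≡0 = proj₂ (components-shape 0 d hi≡0)

-- Successive ranks and blocks in Frobenius coordinates

map-segment : {A B : Set} (f : A → B) (g : ℕ → A) → ∀ i k →
              map f (segment g i k) ≡ segment (f ∘ g) i k
map-segment f g i zero    = refl
map-segment f g i (suc k) = cong (f (g i) ∷_) (map-segment f g (suc i) k)

applyUpTo-segment : {A : Set} (f : ℕ → A) → ∀ n → applyUpTo f n ≡ segment f 0 n
applyUpTo-segment f zero    = refl
applyUpTo-segment f (suc n) =
  cong (f 0 ∷_) (trans (applyUpTo-segment (f ∘ suc) n) (shift 0 n))
  where
  shift : ∀ i k → segment (f ∘ suc) i k ≡ segment f (suc i) k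
  shift i zero    = refl
  shift i (suc k) = cong (f (suc i) ∷_) (shift (suc i) k)

filter-segment : ∀ l i k → i ≤ l → filter (l ≤?_) (segment id i k) ≡ segment id l (i + k ∸ l)
filter-segment l i zero i≤l
  rewrite +-identityʳ i | m≤n⇒m∸n≡0 i≤l = refl
filter-segment l i (suc k) i≤l with l ≤? i
... | no  l≰i = begin
  filter (l ≤?_) (i ∷ segment id (suc i) k)
    ≡⟨ List.filter-reject (l ≤?_) l≰i ⟩
  filter (l ≤?_) (segment id (suc i) k)
    ≡⟨ filter-segment l (suc i) k (≰⇒> l≰i) ⟩
  segment id l (suc i + k ∸ l)
    ≡⟨ cong (λ z → segment id l (z ∸ l)) (+-suc i k) ⟨
  segment id l (i + suc k ∸ l) ∎
... | yes l≤i with refl ← ≤-antisym i≤l l≤i =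
  trans (List.filter-all (l ≤?_) (above i (suc k) ≤-refl))
        (cong (segment id i) (sym (m+n∸m≡n i (suc k))))
  where
  above : ∀ j k → i ≤ j → All (i ≤_) (segment id j k)
  above j zero    _   = []
  above j (suc k) i≤j = i≤j ∷ above (suc j) k (m≤n⇒m≤1+n i≤j)

module Frobenius {π : List ℕ} (dec : Decreasing π) where

  d : ℕ
  d = durfee π

  hi lo : ℕ → ℕ
  hi i = row π i ∸ d
  lo i = column π i ∸ d

  open Blocks lo hi
    (λ i → ∸-monoˡ-≤ d (column-antitone dec (n≤1+n i)))
    (λ i → ∸-monoˡ-≤ d (row-antitone dec (n≤1+n i)))
    public

  row-d : row π d ≤ d
  row-d = ≮⇒≥ (<-irrefl refl ∘ <row⇒<durfee dec)

  d≤column : ∀ {i} → i < d → d ≤ column π i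
  d≤column {i} i<d with d in d≡
  ... | suc e = ≤-trans (<durfee⇒<column dec (subst (e <_) (sym d≡) ≤-refl)) (column-antitone dec (s≤s⁻¹ i<d))

  Dominates : Set
  Dominates = ∀ {i} → i < d → column π i ≤ row π i

  P⁺⇒dominates : P⁺ π → Dominates
  P⁺⇒dominates pos {i} i<d =
    subst (_≤ row π i) (row-conjugate dec i) (ℤ.drop‿+≤+ (ℤ.0≤i-j⇒j≤i (pos i<d)))

  dominates⇒P⁺ : Dominates → P⁺ π
  dominates⇒P⁺ dom {i} i<d =
    ℤ.i≤j⇒0≤j-i (ℤ.+≤+ (subst (_≤ row π i) (sym (row-conjugate dec i)) (dom i<d)))

  skewCells-rows : Dominates → skewCells π ≡ rowsCells 0 d
  skewCells-rows dom = trans (cong (concatMap cellsOf) (applyUpTo-segment id d)) (go 0 d id)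
    where
    cellsOf : ℕ → List Cell
    cellsOf i = map (i ,_) (filter (I π i ≤?_) (upTo (U π i)))
    cellsOf-row : ∀ {i} → i < d → cellsOf i ≡ rowCells i
    cellsOf-row {i} i<d = begin
      map (i ,_) (filter (I π i ≤?_) (upTo (U π i)))
        ≡⟨ cong (map (i ,_) ∘ filter (I π i ≤?_)) (applyUpTo-segment id (U π i)) ⟩
      map (i ,_) (filter (I π i ≤?_) (segment id 0 (U π i)))
        ≡⟨ cong (map (i ,_)) (filter-segment (I π i) 0 (U π i) z≤n) ⟩
      map (i ,_) (segment id (I π i) (U π i ∸ I π i))
        ≡⟨ map-segment (i ,_) id (I π i) (U π i ∸ I π i) ⟩
      cellRun i (I π i) (U π i ∸ I π i)
        ≡⟨ cong₂ (λ l u → cellRun i l (u ∸ l)) (trans (m≥n⇒m⊓n≡n β≤α) β≡lo) (m≥n⇒m⊔n≡m β≤α) ⟩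
      rowCells i ∎
      where
      β≡lo : β π i ≡ lo i
      β≡lo = cong (_∸ d) (row-conjugate dec i)
      β≤α : β π i ≤ α π i
      β≤α = ≤-trans (≤-reflexive β≡lo) (∸-monoˡ-≤ d (dom i<d))
    go : ∀ i k → (∀ {t} → t < i + k → t < d) → concatMap cellsOf (segment id i k) ≡ rowsCells i k
    go i zero    _ = refl
    go i (suc k) < =
      cong₂ _++_ (cellsOf-row (< (m<m+n i (s≤s z≤n))))
                 (go (suc i) k (λ {t} lt → < (subst (t <_) (sym (+-suc i k)) lt)))

  lastCount : ℕ → ℕ → ℕ
  lastCount i k = length (filter last? (segment id i k))

  hi-d : hi d ≡ 0
  hi-d = m≤n⇒m∸n≡0 row-d

  κ-last : Dominates → κ π ≡ lastCount 0 d
  κ-last dom = trans (cong (length ∘ components) (skewCells-rows dom)) (length-components d hi-d)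

  private
    ∸-cancel-< : ∀ {a b} o → a ∸ o < b ∸ o → a < b
    ∸-cancel-< o lt = ≰⇒> λ b≤a → <⇒≱ lt (∸-monoˡ-≤ o b≤a)

    ∸-cancel-≤ : ∀ {a b o} → o ≤ b → a ∸ o ≤ b ∸ o → a ≤ b
    ∸-cancel-≤ o≤b le = ≮⇒≥ λ b<a → <⇒≱ (∸-monoˡ-< b<a o≤b) le

    suc-∸ : ∀ {a b} → b < a → suc (a ∸ suc b) ≡ a ∸ b
    suc-∸ b<a = sym (+-∸-assoc 1 b<a)

    <d : ∀ {i k} → i + suc k ≡ d → i < d
    <d {i} eq = subst (i <_) eq (m<m+n i (s≤s z≤n))

    next : ∀ {i k} → i + suc k ≡ d → suc i + k ≡ d
    next {i} {k} eq = trans (sym (+-suc i k)) eq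

  -- `Last` in Frobenius coordinates. The offset subtracted from row i + 1 is one larger than that
  -- from column i, so the weak inequality between the row and the column becomes a strict one
  -- between arm and leg. Beyond the Durfee square there is no arm left, and the second condition is
  -- vacuous.
  Lands : ℕ → ℕ → Set
  Lands i k = leg π i < arm π i × HeadBelow (leg π i) (segment (arm π) (suc i) k)

  last⇒lands : ∀ {i k} → i + suc k ≡ d → Last i → Lands i k
  last⇒lands {i} {k} eq (lo<hi , hi′≤lo) =
    ∸-monoˡ-< (∸-cancel-< d lo<hi) (<durfee⇒<column dec (<d eq)) , below k (next eq)
    where
    below : ∀ k → suc i + k ≡ d → HeadBelow (leg π i) (segment (arm π) (suc i) k)
    below zero    _  = []
    below (suc k) eq′ =
      ≤-trans (≤-reflexive (suc-∸ (<durfee⇒<row π (<d eq′))))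
              (∸-monoˡ-≤ (suc i) (∸-cancel-≤ (d≤column (<d eq)) hi′≤lo)) ∷ []

  lands⇒last : ∀ {i k} → i + suc k ≡ d → Lands i k → Last i
  lands⇒last {i} {k} eq (leg<arm , head) =
    ∸-monoˡ-< (∸-cancel-< (suc i) leg<arm) (d≤column (<d eq)) , below k (next eq) head
    where
    below : ∀ k → suc i + k ≡ d → HeadBelow (leg π i) (segment (arm π) (suc i) k) → hi (suc i) ≤ lo i
    below zero    eq′ _ =
      ≤-trans (≤-reflexive (trans (cong hi (trans (sym (+-identityʳ (suc i))) eq′)) hi-d)) z≤n
    below (suc k) eq′ (a<l ∷ []) =
      ∸-monoˡ-≤ d (∸-cancel-≤ (<durfee⇒<column dec (<d eq))
        (≤-trans (≤-reflexive (sym (suc-∸ (<durfee⇒<row π (<d eq′))))) a<l))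

  valueFrom : ℕ → ℕ → ℕ → ℕ
  valueFrom m i k = pairValue m (segment (arm π) i k) (segment (leg π) i k)

  valueFrom-dominates : Dominates → ∀ m i k → i + k ≡ d → valueFrom m i k ≡ lastCount i k C m
  valueFrom-dominates dom zero    i zero    _  = refl
  valueFrom-dominates dom (suc m) i zero    _  = refl
  valueFrom-dominates dom m       i (suc k) eq = split (last? i)
    where
    nC0≡1 : ∀ n → n C 0 ≡ 1
    nC0≡1 n = trans (nCk≡nC[n∸k] {0} {n} z≤n) (nCn≡1 n)
    land : ∀ m → landValue m (segment (arm π) (suc i) k) (segment (leg π) (suc i) k)
                 ≡ suc (lastCount (suc i) k) C m
    land zero = trans (valueFrom-dominates dom 0 (suc i) k (next eq))
                      (trans (nC0≡1 (lastCount (suc i) k)) (sym (nC0≡1 (suc (lastCount (suc i) k)))))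
    land (suc m) = begin
      valueFrom (suc m) (suc i) k + valueFrom m (suc i) k
        ≡⟨ cong₂ _+_ (valueFrom-dominates dom (suc m) (suc i) k (next eq))
                     (valueFrom-dominates dom m (suc i) k (next eq)) ⟩
      lastCount (suc i) k C suc m + lastCount (suc i) k C m
        ≡⟨ +-comm (lastCount (suc i) k C suc m) _ ⟩
      lastCount (suc i) k C m + lastCount (suc i) k C suc m
        ≡⟨ nCk+nC[k+1]≡[n+1]C[k+1] (lastCount (suc i) k) m ⟩
      suc (lastCount (suc i) k) C suc m ∎
    split : Dec (Last i) → valueFrom m i (suc k) ≡ lastCount i (suc k) C m
    split (no ¬last) = begin
      valueFrom m i (suc k)
        ≡⟨ pairValue-pass m (∸-monoˡ-≤ (suc i) (dom (<d eq))) (¬last ∘ lands⇒last eq) ⟩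
      valueFrom m (suc i) k
        ≡⟨ valueFrom-dominates dom m (suc i) k (next eq) ⟩
      lastCount (suc i) k C m
        ≡⟨ cong (λ l → length l C m) (List.filter-reject last? ¬last) ⟨
      lastCount i (suc k) C m ∎
    split (yes last) = begin
      valueFrom m i (suc k)
        ≡⟨ pairValue-land m (proj₁ (last⇒lands eq last)) (proj₂ (last⇒lands eq last)) ⟩
      landValue m (segment (arm π) (suc i) k) (segment (leg π) (suc i) k)
        ≡⟨ land m ⟩
      suc (lastCount (suc i) k) C m
        ≡⟨ cong (λ l → length l C m) (List.filter-accept last? last) ⟨
      lastCount i (suc k) C m ∎

  -- A single index where domination fails annihilates the value, since each earlier index only
  -- combines values of the tails. The zeros are stated for all m at once because a counted index
  -- combines two consecutive m.
  valueFrom-fails : ∀ i k → i + k ≡ d →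
    (∀ {t} → i ≤ t → t < d → column π t ≤ row π t) ⊎ (∀ m → valueFrom m i k ≡ 0)
  valueFrom-fails i zero eq =
    inj₁ λ i≤t t<d → contradiction (≤-trans (≤-reflexive (trans (sym eq) (+-identityʳ i))) i≤t) (<⇒≱ t<d)
  valueFrom-fails i (suc k) eq with leg π i ≤? arm π i | valueFrom-fails (suc i) k (next eq)
  ... | no leg≰arm  | _ = inj₂ λ m → pairValue-< m (≰⇒> leg≰arm)
  ... | yes leg≤arm | inj₁ dom = inj₁ λ i≤t t<d → go (m≤n⇒m<n∨m≡n i≤t) t<d
    where
    go : ∀ {t} → i < t ⊎ i ≡ t → t < d → column π t ≤ row π t
    go (inj₁ i<t)  t<d = dom i<t t<d
    go (inj₂ refl) t<d = ∸-cancel-≤ (<durfee⇒<row π t<d) leg≤arm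
  ... | yes leg≤arm | inj₂ zeros = inj₂ λ m → go m (last? i)
    where
    land : ∀ m → landValue m (segment (arm π) (suc i) k) (segment (leg π) (suc i) k) ≡ 0
    land zero    = zeros 0
    land (suc m) = cong₂ _+_ (zeros (suc m)) (zeros m)
    go : ∀ m → Dec (Last i) → valueFrom m i (suc k) ≡ 0
    go m (yes last) =
      trans (pairValue-land m (proj₁ (last⇒lands eq last)) (proj₂ (last⇒lands eq last))) (land m)
    go m (no ¬last) =
      trans (pairValue-pass m leg≤arm (¬last ∘ lands⇒last eq)) (zeros m)

  pairValue-P⁺ : ∀ m → P⁺ π → pairValue m (arms π) (legs π) ≡ κ π C m
  pairValue-P⁺ m pos =
    trans (valueFrom-dominates (P⁺⇒dominates pos) m 0 d refl)
          (cong (_C m) (sym (κ-last (P⁺⇒dominates pos))))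

  pairValue-¬P⁺ : ∀ m → ¬ P⁺ π → pairValue m (arms π) (legs π) ≡ 0
  pairValue-¬P⁺ m ¬pos = go (valueFrom-fails 0 d refl)
    where
    go : (∀ {t} → 0 ≤ t → t < d → column π t ≤ row π t) ⊎ (∀ m → valueFrom m 0 d ≡ 0) →
         valueFrom m 0 d ≡ 0
    go (inj₁ dom)   = ⊥-elim (¬pos (dominates⇒P⁺ (dom z≤n)))
    go (inj₂ zeros) = zeros m

sum-filter-P⁺ : ∀ m {πs} → All Decreasing πs →
  sum (map (λ π → κ π C m) (filter P⁺? πs)) ≡ sum (map (λ π → pairValue m (arms π) (legs π)) πs)
sum-filter-P⁺ m []                 = refl
sum-filter-P⁺ m {π ∷ πs} (dec ∷ decs) = go (P⁺? π)
  where
  go : Dec (P⁺ π) → sum (map (λ π → κ π C m) (filter P⁺? (π ∷ πs)))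
       ≡ pairValue m (arms π) (legs π) + sum (map (λ π → pairValue m (arms π) (legs π)) πs)
  go (yes pos) =
    trans (cong (sum ∘ map (λ π → κ π C m)) (List.filter-accept P⁺? {π} {πs} pos))
          (cong₂ _+_ (sym (Frobenius.pairValue-P⁺ {π} dec m pos)) (sum-filter-P⁺ m decs))
  go (no ¬pos) =
    trans (cong (sum ∘ map (λ π → κ π C m)) (List.filter-reject P⁺? {π} {πs} ¬pos))
          (cong₂ _+_ (sym (Frobenius.pairValue-¬P⁺ {π} dec m ¬pos)) (sum-filter-P⁺ m decs))

-- Order, weight and injectivity of the Frobenius coordinates

descending-segment : ∀ x f i k → (0 < k → f i < x) →
  (∀ {t} → suc t < i + k → f (suc t) < f t) → Descending x (segment f i k)
descending-segment zero    f i zero    _  _    = []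
descending-segment zero    f i (suc k) lt _    = contradiction (lt (s≤s z≤n)) λ ()
descending-segment (suc x) f i zero    _  step = skip (descending-segment x f i zero (λ ()) step)
descending-segment (suc x) f i (suc k) lt step with f i ≟ x
... | no  fi≢x = skip (descending-segment x f i (suc k)
                         (λ 0<k → ≤∧≢⇒< (s≤s⁻¹ (lt 0<k)) fi≢x) step)
... | yes fi≡x =
  subst (λ z → Descending (suc x) (z ∷ segment f (suc i) k)) (sym fi≡x)
    (take (descending-segment x f (suc i) k
      (λ 0<k → subst (f (suc i) <_) fi≡x
        (step (subst (suc (suc i) ≤_) (sym (+-suc i k))
          (subst (_≤ suc (i + k)) (cong suc (+-comm i 1)) (s≤s (+-monoʳ-≤ i 0<k))))))
      (λ {t} lt′ → step (subst (suc t <_) (sym (+-suc i k)) lt′))))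

length-segment : {A : Set} (f : ℕ → A) → ∀ i k → length (segment f i k) ≡ k
length-segment f i zero    = refl
length-segment f i (suc k) = cong suc (length-segment f (suc i) k)

segment-injective : {A : Set} {f g : ℕ → A} → ∀ i k → segment f i k ≡ segment g i k →
                    ∀ {t} → i ≤ t → t < i + k → f t ≡ g t
segment-injective i zero    _  i≤t t<i =
  contradiction (subst (_ <_) (+-identityʳ i) t<i) (≤⇒≯ i≤t)
segment-injective i (suc k) eq {t} i≤t t<k with m≤n⇒m<n∨m≡n i≤t
... | inj₁ i<t  = segment-injective (suc i) k (List.∷-injectiveʳ eq) i<t (subst (t <_) (+-suc i k) t<k)
... | inj₂ refl = List.∷-injectiveˡ eq

weight-arms-legs : ∀ {π} → Decreasing π → weight (arms π) + weight (legs π) ≡ sum π + sum π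
weight-arms-legs {π} dec =
  trans (go 0 (durfee π))
        (cong (λ z → z + z) (sym (sum-hooks (durfee π) dec (<durfee⇒<row π) (Frobenius.row-d dec))))
  where
  shuffle : ∀ a b s t → (suc (a + a) + s) + (suc (b + b) + t) ≡ (suc (a + b) + suc (a + b)) + (s + t)
  shuffle = solve-∀
  hook : ℕ → ℕ
  hook t = suc (arm π t + leg π t)
  go : ∀ i k → weight (segment (arm π) i k) + weight (segment (leg π) i k)
               ≡ sum (segment hook i k) + sum (segment hook i k)
  go i zero    = refl
  go i (suc k) =
    trans (shuffle (arm π i) (leg π i) (weight (segment (arm π) (suc i) k)) _)
          (trans (cong (hook i + hook i +_) (go (suc i) k))
                 (interchange (hook i) (hook i) (sum (segment hook (suc i) k)) _))

private
  shifted-< : ∀ {g : ℕ → ℕ} {t} → g (suc t) ≤ g t → suc t < g (suc t) →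
              g (suc t) ∸ suc (suc t) < g t ∸ suc t
  shifted-< {g} {t} le inside =
    ≤-trans (≤-reflexive (sym (+-∸-assoc 1 inside))) (∸-monoˡ-≤ (suc t) le)

arms-descending : ∀ {π x} → Decreasing π → row π 0 ≤ x → Descending x (arms π)
arms-descending {π} {x} dec row≤x =
  descending-segment x (arm π) 0 (durfee π)
    (λ 0<d → <-≤-trans (∸-monoʳ-< (s≤s z≤n) (<durfee⇒<row π 0<d)) row≤x)
    (λ {t} t<d → shifted-< {row π} (row-antitone dec (n≤1+n t)) (<durfee⇒<row π t<d))

legs-descending : ∀ {π x} → Decreasing π → column π 0 ≤ x → Descending x (legs π)
legs-descending {π} {x} dec column≤x =
  descending-segment x (leg π) 0 (durfee π)
    (λ 0<d → <-≤-trans (∸-monoʳ-< (s≤s z≤n) (<durfee⇒<column dec 0<d)) column≤x)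
    (λ {t} t<d → shifted-< {column π} (column-antitone dec (n≤1+n t)) (<durfee⇒<column dec t<d))

-- A cell outside the first d rows lies in the first d columns, so the rows
-- inside and the columns inside determine the diagram.
arms-legs-row-≤ : ∀ {π ρ} → Decreasing π → Decreasing ρ → arms π ≡ arms ρ → legs π ≡ legs ρ →
                  ∀ i → row π i ≤ row ρ i
arms-legs-row-≤ {π} {ρ} decπ decρ as≡ bs≡ i = split (i <? durfee π)
  where
  d≡ : durfee π ≡ durfee ρ
  d≡ = trans (sym (length-segment (arm π) 0 (durfee π)))
             (trans (cong length as≡) (length-segment (arm ρ) 0 (durfee ρ)))
  arm≡ : ∀ {t} → t < durfee π → arm π t ≡ arm ρ t
  arm≡ = segment-injective 0 (durfee π) (trans as≡ (cong (segment (arm ρ) 0) (sym d≡))) z≤n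
  leg≡ : ∀ {t} → t < durfee π → leg π t ≡ leg ρ t
  leg≡ = segment-injective 0 (durfee π) (trans bs≡ (cong (segment (leg ρ) 0) (sym d≡))) z≤n
  column≡ : ∀ {j} → j < durfee π → column π j ≡ column ρ j
  column≡ {j} j<d = begin
    column π j         ≡⟨ m∸n+n≡m (<durfee⇒<column decπ j<d) ⟨
    leg π j + suc j    ≡⟨ cong (_+ suc j) (leg≡ j<d) ⟩
    leg ρ j + suc j    ≡⟨ m∸n+n≡m (<durfee⇒<column decρ (subst (j <_) d≡ j<d)) ⟩
    column ρ j ∎
  outside : durfee π ≤ i → ∀ {j} → j < row π i → j < row ρ i
  outside d≤i j<row = column⇒row decρ (subst (i <_) (column≡ j<d) (row⇒column decπ j<row))
    where
    j<d = <-≤-trans j<row (≤-trans (row-antitone decπ d≤i) (Frobenius.row-d decπ))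
  split : Dec (i < durfee π) → row π i ≤ row ρ i
  split (yes i<d) = ≤-reflexive (begin
    row π i                ≡⟨ m∸n+n≡m (<durfee⇒<row π i<d) ⟨
    arm π i + suc i        ≡⟨ cong (_+ suc i) (arm≡ i<d) ⟩
    arm ρ i + suc i        ≡⟨ m∸n+n≡m (<durfee⇒<row ρ (subst (i <_) d≡ i<d)) ⟩
    row ρ i ∎)
  split (no i≮d) = ≮⇒≥ λ lt → <-irrefl refl (outside (≮⇒≥ i≮d) lt)

row-injective : ∀ {π ρ} → All (0 <_) π → All (0 <_) ρ → (∀ i → row π i ≡ row ρ i) → π ≡ ρ
row-injective []         []         _  = refl
row-injective []         (py ∷ _)   eq = contradiction (eq 0) (<⇒≢ py)
row-injective (px ∷ _)   []         eq = contradiction (sym (eq 0)) (<⇒≢ px)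
row-injective (px ∷ pxs) (py ∷ pys) eq = cong₂ _∷_ (eq 0) (row-injective pxs pys (eq ∘ suc))

arms-legs-injective : ∀ {π ρ n} → π ⊢ n → ρ ⊢ n → arms π ≡ arms ρ → legs π ≡ legs ρ → π ≡ ρ
arms-legs-injective {π} {ρ} (partition posπ decπ _) (partition posρ decρ _) as≡ bs≡ =
  row-injective posπ posρ λ i →
    ≤-antisym (arms-legs-row-≤ decπ decρ as≡ bs≡ i) (arms-legs-row-≤ decρ decπ (sym as≡) (sym bs≡) i)

row-≤-sum : ∀ π → row π 0 ≤ sum π
row-≤-sum []      = z≤n
row-≤-sum (x ∷ π) = m≤m+n x (sum π)

length-≤-sum : ∀ {π} → All (0 <_) π → length π ≤ sum π
length-≤-sum []         = z≤n
length-≤-sum (px ∷ pxs) = +-mono-≤ px (length-≤-sum pxs)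

column-≤-length : ∀ π → column π 0 ≤ length π
column-≤-length π = List.length-filter (0 <?_) π

-- Partitions and walks

open import Data.Integer using (+_; _-_)

module _ {A : Set} where

  unique-⊆-split : ∀ {xs ys : List A} → Unique xs → (∀ {v} → v ∈ xs → v ∈ ys) →
                   Σ[ zs ∈ List A ] ys ↭ xs ++ zs
  unique-⊆-split {[]}     {ys} _        _   = ys , ↭-refl
  unique-⊆-split {x ∷ xs} (x∉ ∷ u) sub with ∈-∃++ (sub (here refl))
  ... | as , bs , refl =
    let zs , perm = unique-⊆-split u (λ v∈ → remove (All.lookup x∉ v∈) (sub (there v∈)))
    in zs , ↭-trans (Perm.shift x as bs) (prep x perm)
    where
    remove : ∀ {v} → x ≢ v → v ∈ as ++ x ∷ bs → v ∈ as ++ bs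
    remove x≢v v∈ with ∈-++⁻ as v∈
    ... | inj₁ v∈as         = ∈-++⁺ˡ v∈as
    ... | inj₂ (here v≡x)   = contradiction (sym v≡x) x≢v
    ... | inj₂ (there v∈bs) = ∈-++⁺ʳ as v∈bs

  unique-⊆-length : ∀ {xs ys : List A} → Unique xs → (∀ {v} → v ∈ xs → v ∈ ys) →
                    length xs ≤ length ys
  unique-⊆-length {xs} {ys} u sub =
    let zs , perm = unique-⊆-split u sub
    in ≤-trans (m≤m+n (length xs) (length zs))
               (≤-reflexive (sym (trans (Perm.↭-length perm) (List.length-++ xs))))

  -- Pigeonhole: the distinct entries of `xs` already fill a list of the same length. It stands in
  -- for an inverse of the Frobenius map.
  unique-⊆-↭ : ∀ {xs ys : List A} → Unique xs → (∀ {v} → v ∈ xs → v ∈ ys) →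
               length ys ≡ length xs → ys ↭ xs
  unique-⊆-↭ {xs} {ys} u sub eq with unique-⊆-split u sub
  ... | []     , perm = ↭-trans perm (↭-reflexive (List.++-identityʳ xs))
  ... | z ∷ zs , perm =
    contradiction (trans (sym eq) (trans (Perm.↭-length perm) (List.length-++ xs)))
                  (<⇒≢ (m<m+n (length xs) (s≤s z≤n)))

  unique-map : ∀ {B : Set} (f : A → B) {xs} →
    (∀ {u v} → u ∈ xs → v ∈ xs → f u ≡ f v → u ≡ v) → Unique xs → Unique (map f xs)
  unique-map f inj []       = []
  unique-map f {x ∷ xs} inj (x∉ ∷ u) =
    All.tabulate fresh ∷ unique-map f (λ u∈ v∈ → inj (there u∈) (there v∈)) u
    where
    fresh : ∀ {y} → y ∈ map f xs → f x ≢ y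
    fresh y∈ fx≡y with ∈-map⁻ f y∈
    ... | v , v∈ , y≡fv = All.lookup x∉ v∈ (inj (here refl) (there v∈) (trans fx≡y y≡fv))

  ∈-delay : ∀ {v : A} k f n → v ∈ delay [] k f n → Σ[ l ∈ ℕ ] k + l ≡ n × v ∈ f l
  ∈-delay zero    f n       v∈ = n , refl , v∈
  ∈-delay (suc k) f (suc n) v∈ = let l , eq , v∈′ = ∈-delay k f n v∈ in l , cong suc eq , v∈′

-- The number of partitions as a box count

boxPartitions : ℕ → ℕ → ℕ → List (List ℕ)
boxPartitions zero    b       zero    = [] ∷ []
boxPartitions zero    b       (suc n) = []
boxPartitions (suc a) zero    zero    = [] ∷ []
boxPartitions (suc a) zero    (suc n) = []
boxPartitions (suc a) (suc b) n =
  boxPartitions (suc a) b n ++ map (suc b ∷_) (delay [] (suc b) (boxPartitions a (suc b)) n)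

length-boxPartitions : ∀ a b n → length (boxPartitions a b n) ≡ boxCount a b n
length-boxPartitions zero    b       zero    = refl
length-boxPartitions zero    b       (suc n) = refl
length-boxPartitions (suc a) zero    zero    = refl
length-boxPartitions (suc a) zero    (suc n) = refl
length-boxPartitions (suc a) (suc b) n =
  trans (List.length-++ (boxPartitions (suc a) b n))
    (cong₂ _+_ (length-boxPartitions (suc a) b n)
      (trans (List.length-map (suc b ∷_) (delay [] (suc b) (boxPartitions a (suc b)) n))
      (trans (delay-homo length (suc b) (boxPartitions a (suc b)) n)
             (delay-cong (suc b) (length-boxPartitions a (suc b)) n))))

∈-boxPartitions⁻ : ∀ a b n {π} → π ∈ boxPartitions a b n → π ⊢ n × row π 0 ≤ b
∈-boxPartitions⁻ zero    b    zero (here refl) = partition [] [] refl , z≤n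
∈-boxPartitions⁻ (suc a) zero zero (here refl) = partition [] [] refl , z≤n
∈-boxPartitions⁻ (suc a) (suc b) n π∈ with ∈-++⁻ (boxPartitions (suc a) b n) π∈
... | inj₁ π∈ˡ = let π⊢n , row≤ = ∈-boxPartitions⁻ (suc a) b n π∈ˡ in π⊢n , m≤n⇒m≤1+n row≤
... | inj₂ π∈ʳ with ∈-map⁻ (suc b ∷_) π∈ʳ
... | ρ , ρ∈ , refl with ∈-delay (suc b) (boxPartitions a (suc b)) n ρ∈
... | l , refl , ρ∈′ =
  let partition pos dec size , row≤ = ∈-boxPartitions⁻ a (suc b) l ρ∈′
  in partition (s≤s z≤n ∷ pos) (extend dec row≤) (cong (λ z → suc b + z) size) , ≤-refl
  where
  extend : ∀ {ρ} → Linked _≥_ ρ → row ρ 0 ≤ suc b → Linked _≥_ (suc b ∷ ρ)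
  extend {[]}    _   _  = [-]
  extend {_ ∷ _} dec le = le ∷ dec

∈-boxPartitions⁺ : ∀ a b n {π} → π ⊢ n → length π ≤ a → row π 0 ≤ b → π ∈ boxPartitions a b n
∈-boxPartitions⁺ zero    b    n {[]}    (partition _ _ refl) _ _ = here refl
∈-boxPartitions⁺ (suc a) zero n {[]}    (partition _ _ refl) _ _ = here refl
∈-boxPartitions⁺ (suc a) zero n {x ∷ π} (partition (px ∷ _) _ _) _ x≤0 = contradiction px (≤⇒≯ x≤0)
∈-boxPartitions⁺ (suc a) (suc b) n {[]} π⊢n len _ =
  ∈-++⁺ˡ (∈-boxPartitions⁺ (suc a) b n π⊢n len z≤n)
∈-boxPartitions⁺ (suc a) (suc b) n {x ∷ π} π⊢n@(partition (px ∷ pos) dec refl) (s≤s len) x≤1+b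
  with m≤n⇒m<n∨m≡n x≤1+b
... | inj₁ (s≤s x≤b) = ∈-++⁺ˡ (∈-boxPartitions⁺ (suc a) b n π⊢n (s≤s len) x≤b)
... | inj₂ refl =
  ∈-++⁺ʳ (boxPartitions (suc a) b n) (∈-map⁺ (suc b ∷_)
    (subst (π ∈_) (sym (delay-shift (suc b) (boxPartitions a (suc b)) (sum π)))
      (∈-boxPartitions⁺ a (suc b) (sum π) (partition pos (Linked.tail dec) refl) len (row-≤-head dec 0))))

boxPartitions-unique : ∀ a b n → Unique (boxPartitions a b n)
boxPartitions-unique zero    b       zero    = [] ∷ []
boxPartitions-unique zero    b       (suc n) = []
boxPartitions-unique (suc a) zero    zero    = [] ∷ []
boxPartitions-unique (suc a) zero    (suc n) = []
boxPartitions-unique (suc a) (suc b) n =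
  Unique.++⁺ (boxPartitions-unique (suc a) b n)
    (Unique.map⁺ List.∷-injectiveʳ (delayed (suc b) n))
    disjoint
  where
  delayed : ∀ k n → Unique (delay [] k (boxPartitions a (suc b)) n)
  delayed zero    n       = boxPartitions-unique a (suc b) n
  delayed (suc k) zero    = []
  delayed (suc k) (suc n) = delayed k n
  disjoint : ∀ {π} → ¬ (π ∈ boxPartitions (suc a) b n
                        × π ∈ map (suc b ∷_) (delay [] (suc b) (boxPartitions a (suc b)) n))
  disjoint (π∈ˡ , π∈ʳ) with ∈-map⁻ (suc b ∷_) π∈ʳ
  ... | _ , _ , refl = 1+n≰n (proj₂ (∈-boxPartitions⁻ (suc a) b n π∈ˡ))

p-boxCount : ∀ {a b n} → n ≤ a → n ≤ b → p (+ n) ≡ boxCount a b n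
p-boxCount {a} {b} {n} n≤a n≤b = trans
  (≤-antisym
    (unique-⊆-length (partitions-unique n) inBox)
    (unique-⊆-length (boxPartitions-unique a b n)
                     (λ π∈ → ∈-partitions⁺ (proj₁ (∈-boxPartitions⁻ a b n π∈)))))
  (length-boxPartitions a b n)
  where
  inBox : ∀ {π} → π ∈ partitions n → π ∈ boxPartitions a b n
  inBox {π} π∈ =
    let π⊢n = ∈-partitions⁻ {n = n} π∈
        open _⊢_ π⊢n
    in ∈-boxPartitions⁺ a b n π⊢n
         (≤-trans (≤-trans (length-≤-sum positive) (≤-reflexive size)) n≤a)
         (≤-trans (≤-trans (row-≤-sum π) (≤-reflexive size)) n≤b)

coordinates : ∀ {x} → Word x → List ℕ × List ℕ
coordinates w = upper w , lower w

bridges : ∀ x → ℕ → List (Word x)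
bridges x N = filter (λ w → bridge 0 0 w ≟ 1) (words x N)

length-bridges : ∀ x n → n ≤ x → length (bridges x (n + n)) ≡ p (+ n)
length-bridges x n n≤x = begin
  length (bridges x (n + n))
    ≡⟨ count (words x (n + n)) ⟩
  total x (bridge 0 0) (n + n)
    ≡⟨ total-bridge-up x 0 (n + n) ⟩
  endCount x 0 (n + n)
    ≡⟨ endCount-boxCount x x x 0 (+-identityʳ x) (sym (+-identityʳ x)) (n + n) ⟩
  dilate (boxCount x x) (n + n)
    ≡⟨ dilate-double (boxCount x x) n ⟩
  boxCount x x n
    ≡⟨ p-boxCount n≤x n≤x ⟨
  p (+ n) ∎
  where
  count : ∀ ws → length (filter (λ w → bridge 0 0 w ≟ 1) ws) ≡ sum (map (bridge 0 0) ws)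
  count []       = refl
  count (w ∷ ws) with bridge 0 0 w in eq
  ... | zero        = count ws
  ... | suc zero    = cong suc (count ws)
  ... | suc (suc k) = contradiction (subst (_≤ 1) eq (bridge-≤1 0 0 w)) λ { (s≤s ()) }

total-bridges : ∀ x m N → walkTotal x 0 m N ≡ sum (map (walkValue 0 m) (bridges x N))
total-bridges x m N = go (words x N)
  where
  go : ∀ ws → sum (map (walkValue 0 m) ws)
              ≡ sum (map (walkValue 0 m) (filter (λ w → bridge 0 0 w ≟ 1) ws))
  go []       = refl
  go (w ∷ ws) with bridge 0 0 w in eq
  ... | zero        = cong₂ _+_ (walkValue-bridge 0 m w eq) (go ws)
  ... | suc zero    = cong (λ z → walkValue 0 m w + z) (go ws)
  ... | suc (suc k) = contradiction (subst (_≤ 1) eq (bridge-≤1 0 0 w)) λ { (s≤s ()) }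

record Encoded {x} (w : Word x) : Set where
  constructor encoded
  field
    {as bs} : List ℕ
    upperD  : Descending x as
    lowerD  : Descending x bs
    isCode  : encode upperD lowerD ≡ w

word-encoded : ∀ {x} (w : Word x) → Encoded w
word-encoded []          = encoded [] [] refl
word-encoded (level ∷ w) =
  let encoded d e eq = word-encoded w
  in encoded (skip d) (skip e) (cong (level ∷_) eq)
word-encoded (both ∷ w) =
  let encoded d e eq = word-encoded w
  in encoded (take d) (take e) (cong (both ∷_) eq)
word-encoded (up ∷ w) =
  let encoded d e eq = word-encoded w
  in encoded (take d) (skip e) (cong (up ∷_) eq)
word-encoded (down ∷ w) =
  let encoded d e eq = word-encoded w
  in encoded (skip d) (take e) (cong (down ∷_) eq)

walkValue-coordinates : ∀ {x} m (w : Word x) → walkValue 0 m w ≡ uncurry (pairValue m) (coordinates w)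
walkValue-coordinates m w with encoded d e refl ← word-encoded w =
  trans (encode-walkValue m [] [] d e)
        (sym (cong₂ (pairValue m) (upper-encode d e) (lower-encode d e)))

frobenius : List ℕ → List ℕ × List ℕ
frobenius π = arms π , legs π

-- Every partition yields a balanced word of weight 2n, different partitions yield different
-- coordinates, and by `length-bridges` the two lists are equally long.
coordinates-↭ : ∀ {x n} → n ≤ x → map coordinates (bridges x (n + n)) ↭ map frobenius (partitions n)
coordinates-↭ {x} {n} n≤x = unique-⊆-↭
  (unique-map frobenius
    (λ π∈ ρ∈ eq → arms-legs-injective (∈-partitions⁻ {n = n} π∈) (∈-partitions⁻ {n = n} ρ∈)
                                      (cong proj₁ eq) (cong proj₂ eq))
    (partitions-unique n))
  included
  (trans (List.length-map coordinates (bridges x (n + n)))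
  (trans (length-bridges x n n≤x) (sym (List.length-map frobenius (partitions n)))))
  where
  included : ∀ {v} → v ∈ map frobenius (partitions n) → v ∈ map coordinates (bridges x (n + n))
  included v∈ with ∈-map⁻ frobenius v∈
  ... | π , π∈ , refl =
    subst (_∈ map coordinates (bridges x (n + n))) (cong₂ _,_ (upper-encode d e) (lower-encode d e))
      (∈-map⁺ coordinates (∈-filter⁺ (λ w → bridge 0 0 w ≟ 1)
        (subst (λ N → encode d e ∈ words x N)
               (trans (weight-arms-legs decreasing) (cong (λ z → z + z) size))
               (∈-words d e))
        (encode-bridge 0 0 d e
          (trans (length-segment (arm π) 0 (durfee π)) (sym (length-segment (leg π) 0 (durfee π)))))))
    where
    open _⊢_ (∈-partitions⁻ {n = n} π∈)
    d : Descending x (arms π)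
    d = arms-descending decreasing (≤-trans (≤-trans (row-≤-sum π) (≤-reflexive size)) n≤x)
    e : Descending x (legs π)
    e = legs-descending decreasing
          (≤-trans (column-≤-length π) (≤-trans (≤-trans (length-≤-sum positive) (≤-reflexive size)) n≤x))

blockSum-walkTotal : ∀ m {x n} → n ≤ x → blockSum m n ≡ walkTotal x 0 m (n + n)
blockSum-walkTotal m {x} {n} n≤x = begin
  blockSum m n
    ≡⟨ sum-filter-P⁺ m (All.tabulate (_⊢_.decreasing ∘ ∈-partitions⁻ {n = n})) ⟩
  sum (map (uncurry (pairValue m) ∘ frobenius) (partitions n))
    ≡⟨ cong sum (List.map-∘ (partitions n)) ⟩
  sum (map (uncurry (pairValue m)) (map frobenius (partitions n)))
    ≡⟨ sum-↭ (Perm.map⁺ (uncurry (pairValue m)) (coordinates-↭ n≤x)) ⟨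
  sum (map (uncurry (pairValue m)) (map coordinates (bridges x (n + n))))
    ≡⟨ cong sum (List.map-∘ (bridges x (n + n))) ⟨
  sum (map (uncurry (pairValue m) ∘ coordinates) (bridges x (n + n)))
    ≡⟨ cong sum (List.map-cong (walkValue-coordinates m) (bridges x (n + n))) ⟨
  sum (map (walkValue 0 m) (bridges x (n + n)))
    ≡⟨ total-bridges x m (n + n) ⟨
  walkTotal x 0 m (n + n) ∎

-- The generating function of the partitions

shift : ℕ → Series → Series
shift = delay 0ℤ

⊛-cong-≤ : ∀ {A A′ B B′} n → (∀ {k} → k ≤ n → A k ≡ A′ k) → (∀ {k} → k ≤ n → B k ≡ B′ k) →
           (A ⊛ B) n ≡ (A′ ⊛ B′) n
⊛-cong-≤ zero    eqA eqB = cong (ℤ._+ 0ℤ) (cong₂ ℤ._*_ (eqA z≤n) (eqB z≤n))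
⊛-cong-≤ (suc n) eqA eqB =
  cong₂ ℤ._+_ (cong₂ ℤ._*_ (eqA z≤n) (eqB ≤-refl))
              (⊛-cong-≤ n (eqA ∘ s≤s) (eqB ∘ m≤n⇒m≤1+n))

⊛-distribʳ : ∀ A A′ B → (A ⊖ A′) ⊛ B ≈ (A ⊛ B) ⊖ (A′ ⊛ B)
⊛-distribʳ A A′ B zero    = lemma (A 0) (A′ 0) (B 0)
  where
  lemma : ∀ a a′ b → (a ℤ.- a′) ℤ.* b ℤ.+ 0ℤ ≡ (a ℤ.* b ℤ.+ 0ℤ) ℤ.- (a′ ℤ.* b ℤ.+ 0ℤ)
  lemma = ℤSolver.solve-∀
⊛-distribʳ A A′ B (suc n) =
  trans (cong (λ z → (A 0 ℤ.- A′ 0) ℤ.* B (suc n) ℤ.+ z) (⊛-distribʳ (A ∘ suc) (A′ ∘ suc) B n))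
        (lemma (A 0) (A′ 0) (B (suc n)) _ _)
  where
  lemma : ∀ a a′ b x y → (a ℤ.- a′) ℤ.* b ℤ.+ (x ℤ.- y) ≡ (a ℤ.* b ℤ.+ x) ℤ.- (a′ ℤ.* b ℤ.+ y)
  lemma = ℤSolver.solve-∀

⊛-distribˡ : ∀ A B B′ → A ⊛ (B ⊖ B′) ≈ (A ⊛ B) ⊖ (A ⊛ B′)
⊛-distribˡ A B B′ zero    = lemma (A 0) (B 0) (B′ 0)
  where
  lemma : ∀ a b b′ → a ℤ.* (b ℤ.- b′) ℤ.+ 0ℤ ≡ (a ℤ.* b ℤ.+ 0ℤ) ℤ.- (a ℤ.* b′ ℤ.+ 0ℤ)
  lemma = ℤSolver.solve-∀
⊛-distribˡ A B B′ (suc n) =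
  trans (cong (λ z → A 0 ℤ.* (B (suc n) ℤ.- B′ (suc n)) ℤ.+ z) (⊛-distribˡ (A ∘ suc) B B′ n))
        (lemma (A 0) (B (suc n)) (B′ (suc n)) _ _)
  where
  lemma : ∀ a b b′ x y → a ℤ.* (b ℤ.- b′) ℤ.+ (x ℤ.- y) ≡ (a ℤ.* b ℤ.+ x) ℤ.- (a ℤ.* b′ ℤ.+ y)
  lemma = ℤSolver.solve-∀

shift-⊛ : ∀ k A B → shift k A ⊛ B ≈ shift k (A ⊛ B)
shift-⊛ zero    A B n       = refl
shift-⊛ (suc k) A B zero    = cong (ℤ._+ 0ℤ) (ℤ.*-zeroˡ (B 0))
shift-⊛ (suc k) A B (suc n) =
  trans (cong₂ ℤ._+_ (ℤ.*-zeroˡ (B (suc n))) (shift-⊛ k A B n)) (ℤ.+-identityˡ _)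

⊛-shift : ∀ k A B → A ⊛ shift k B ≈ shift k (A ⊛ B)
⊛-shift zero    A B n       = refl
⊛-shift (suc k) A B zero    = cong (ℤ._+ 0ℤ) (ℤ.*-zeroʳ (A 0))
⊛-shift (suc k) A B (suc n) = trans (tail A (shift (suc k) B) refl n) (⊛-shift k A B n)
  where
  tail : ∀ A E → E 0 ≡ 0ℤ → ∀ n → (A ⊛ E) (suc n) ≡ (A ⊛ (E ∘ suc)) n
  tail A E E₀ zero =
    cong (λ z → A 0 ℤ.* E 1 ℤ.+ (z ℤ.+ 0ℤ)) (trans (cong (A 1 ℤ.*_) E₀) (ℤ.*-zeroʳ (A 1)))
  tail A E E₀ (suc n) = cong (λ z → A 0 ℤ.* E (suc (suc n)) ℤ.+ z) (tail (A ∘ suc) E E₀ n)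

private
  ⊛-zeroˡ : ∀ B → (λ _ → 0ℤ) ⊛ B ≈ λ _ → 0ℤ
  ⊛-zeroˡ B zero    = refl
  ⊛-zeroˡ B (suc n) = trans (cong₂ ℤ._+_ (ℤ.*-zeroˡ (B (suc n))) (⊛-zeroˡ B n)) (ℤ.+-identityˡ 0ℤ)

⊛-oneˡ : ∀ B → q^ 0 ⊛ B ≈ B
⊛-oneˡ B zero    = trans (ℤ.+-identityʳ _) (ℤ.*-identityˡ (B 0))
⊛-oneˡ B (suc n) =
  trans (cong₂ ℤ._+_ (ℤ.*-identityˡ (B (suc n))) (⊛-zeroˡ B n)) (ℤ.+-identityʳ _)

⊛-oneʳ : ∀ A → A ⊛ q^ 0 ≈ A
⊛-oneʳ A zero    = trans (ℤ.+-identityʳ _) (ℤ.*-identityʳ (A 0))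
⊛-oneʳ A (suc n) =
  trans (cong₂ ℤ._+_ (ℤ.*-zeroʳ (A 0)) (⊛-oneʳ (A ∘ suc) n)) (ℤ.+-identityˡ _)

q^-shift : ∀ k → q^ k ≈ shift k (q^ 0)
q^-shift zero    n       = refl
q^-shift (suc k) zero    = refl
q^-shift (suc k) (suc n) = q^-shift k n

q^-⊛ : ∀ k B → q^ k ⊛ B ≈ shift k B
q^-⊛ k B n = begin
  (q^ k ⊛ B) n            ≡⟨ ⊛-cong-≤ {B = B} n (λ {i} _ → q^-shift k i) (λ _ → refl) ⟩
  (shift k (q^ 0) ⊛ B) n  ≡⟨ shift-⊛ k (q^ 0) B n ⟩
  shift k (q^ 0 ⊛ B) n    ≡⟨ delay-cong k (⊛-oneˡ B) n ⟩
  shift k B n ∎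

⊛-one-minus-q^ : ∀ k A → A ⊛ (q^ 0 ⊖ q^ k) ≈ A ⊖ shift k A
⊛-one-minus-q^ k A n = begin
  (A ⊛ (q^ 0 ⊖ q^ k)) n
    ≡⟨ ⊛-distribˡ A (q^ 0) (q^ k) n ⟩
  (A ⊛ q^ 0) n ℤ.- (A ⊛ q^ k) n
    ≡⟨ cong₂ ℤ._-_ (⊛-oneʳ A n)
         (trans (⊛-cong-≤ {A} n (λ _ → refl) (λ {i} _ → q^-shift k i))
         (trans (⊛-shift k A (q^ 0) n) (delay-cong k (⊛-oneʳ A) n))) ⟩
  A n ℤ.- shift k A n ∎

-- Strong induction on the degree: once the lower coefficients agree, the top coefficient enters the
-- product only through the factor `B 0`.
⊛-cancelˡ : ∀ {B E F} → B 0 ≡ 1ℤ → B ⊛ E ≈ B ⊛ F → E ≈ F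
⊛-cancelˡ {B} {E} {F} B₀ eq n = below n ≤-refl
  where
  head : ∀ {x y} → B 0 ℤ.* x ≡ B 0 ℤ.* y → x ≡ y
  head {x} {y} e = trans (sym (one x)) (trans e (one y))
    where
    one : ∀ z → B 0 ℤ.* z ≡ z
    one z = trans (cong (ℤ._* z) B₀) (ℤ.*-identityˡ z)
  below : ∀ n {k} → k ≤ n → E k ≡ F k
  below zero    z≤n = head (+-cancelʳ 0ℤ _ _ (eq 0))
  below (suc n) {k} k≤1+n with m≤n⇒m<n∨m≡n k≤1+n
  ... | inj₁ k<1+n = below n (s≤s⁻¹ k<1+n)
  ... | inj₂ refl  =
    head (+-cancelʳ ((B ∘ suc ⊛ E) n) _ _
      (trans (eq (suc n))
        (cong (λ z → B 0 ℤ.* F (suc n) ℤ.+ z)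
              (sym (⊛-cong-≤ {B ∘ suc} n (λ _ → refl) (below n))))))

-- A partition of n has at most n parts, so this counts all the partitions of
-- n into parts of size at most b.
boundedSeries : ℕ → Series
boundedSeries b n = + boxCount n b n

boundedSeries-suc : ∀ b → boundedSeries (suc b) ⊖ shift (suc b) (boundedSeries (suc b)) ≈ boundedSeries b
boundedSeries-suc b n = begin
  + boxCount n (suc b) n ℤ.- shift (suc b) (boundedSeries (suc b)) n
    ≡⟨ cong₂ ℤ._-_ (cong +_ (split n)) (sym (delay-homo +_ (suc b) _ n)) ⟩
  + (boxCount n b n + delay₀ (suc b) (λ i → boxCount i (suc b) i) n)
    ℤ.- + delay₀ (suc b) (λ i → boxCount i (suc b) i) n
    ≡⟨ cancel (boxCount n b n) (delay₀ (suc b) (λ i → boxCount i (suc b) i) n) ⟩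
  + boxCount n b n ∎
  where
  cancel : ∀ x y → + (x + y) ℤ.- + y ≡ + x
  cancel x y = trans (ℤ.+-assoc (+ x) (+ y) (ℤ.- + y))
                     (trans (cong (λ z → + x ℤ.+ z) (ℤ.+-inverseʳ (+ y))) (ℤ.+-identityʳ (+ x)))
  split : ∀ n → boxCount n (suc b) n ≡ boxCount n b n + delay₀ (suc b) (λ i → boxCount i (suc b) i) n
  split zero    = refl
  -- The recursion allows n parts in the remainder, the diagonal series only i at degree i; since i
  -- ≤ n, both bounds are vacuous there.
  split (suc n) = cong (λ z → boxCount (suc n) b (suc n) + z)
    (delay-cong-≤ (suc b) (λ {i} i+1+b≤1+n →
      boxCount-stable (suc b) (≤-trans (m≤m+n i b) (s≤s⁻¹ (subst (_≤ suc n) (+-suc i b) i+1+b≤1+n))) ≤-refl))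

pochhammer-boundedSeries : ∀ N → pochhammer N ⊛ boundedSeries N ≈ q^ 0
pochhammer-boundedSeries zero n =
  trans (⊛-oneˡ (boundedSeries 0) n) (trans (cong +_ (boxCount-zeroʳ n n)) (lemma n))
  where
  lemma : ∀ n → + δ n ≡ (q^ 0) n
  lemma zero    = refl
  lemma (suc n) = refl
pochhammer-boundedSeries (suc N) n = begin
  (pochhammer (suc N) ⊛ B) n
    ≡⟨ ⊛-cong-≤ {B = B} n (λ {i} _ → ⊛-one-minus-q^ (suc N) (pochhammer N) i) (λ _ → refl) ⟩
  ((pochhammer N ⊖ shift (suc N) (pochhammer N)) ⊛ B) n
    ≡⟨ ⊛-distribʳ (pochhammer N) (shift (suc N) (pochhammer N)) B n ⟩
  (pochhammer N ⊛ B) n ℤ.- (shift (suc N) (pochhammer N) ⊛ B) n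
    ≡⟨ cong (λ z → (pochhammer N ⊛ B) n ℤ.- z)
            (trans (shift-⊛ (suc N) (pochhammer N) B n) (sym (⊛-shift (suc N) (pochhammer N) B n))) ⟩
  (pochhammer N ⊛ B) n ℤ.- (pochhammer N ⊛ shift (suc N) B) n
    ≡⟨ ⊛-distribˡ (pochhammer N) B (shift (suc N) B) n ⟨
  (pochhammer N ⊛ (B ⊖ shift (suc N) B)) n
    ≡⟨ ⊛-cong-≤ {pochhammer N} n (λ _ → refl) (λ {i} _ → boundedSeries-suc N i) ⟩
  (pochhammer N ⊛ boundedSeries N) n
    ≡⟨ pochhammer-boundedSeries N n ⟩
  (q^ 0) n ∎
  where
  B : Series
  B = boundedSeries (suc N)

recip-pochhammer∞ : recip pochhammer∞ ≈ +_ ∘ p ∘ +_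
recip-pochhammer∞ = ⊛-cancelˡ {pochhammer∞} refl λ n → begin
  (pochhammer∞ ⊛ recip pochhammer∞) n
    ≡⟨ recip-correct pochhammer∞ refl n ⟩
  (q^ 0) n
    ≡⟨ pochhammer-boundedSeries n n ⟨
  (pochhammer n ⊛ boundedSeries n) n
    -- Degree n involves only coefficients k ≤ n, where (q;q)_n agrees with the infinite product and
    -- parts of size at most n are no restriction.
    ≡⟨ ⊛-cong-≤ n pochhammer-stable (λ k≤n → cong +_ (sym (p-boxCount ≤-refl k≤n))) ⟩
  (pochhammer∞ ⊛ (+_ ∘ p ∘ +_)) n ∎

-- Reading off the coefficients

p-delay : ∀ n k → p (+ n - + k) ≡ delay₀ k (p ∘ +_) n
p-delay n k = trans (cong p (ℤ.m-n≡m⊖n n k)) (go n k)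
  where
  go : ∀ n k → p (n ℤ.⊖ k) ≡ delay₀ k (p ∘ +_) n
  go n       zero    = refl
  go zero    (suc k) = refl
  go (suc n) (suc k) = trans (cong p (ℤ.[1+m]⊖[1+n]≡m⊖n n k)) (go n k)

-- The triple product contributes the exponent (2m)² = 2 · 2m², which undoing the dilation halves to
-- 2m². With n ≤ a the box is too large to restrict the partitions that remain.
endCount-p : ∀ m {a x n} → a + double m ≡ x → n ≤ a →
             endCount x (double m) (n + n) ≡ p (+ n - + (2 * m ^ 2))
endCount-p m {a} {x} {n} a+2m≡x n≤a = begin
  endCount x (double m) (n + n)
    ≡⟨ endCount-boxCount x a b (double m) a+2m≡x refl (n + n) ⟩
  delay₀ (double m * double m) (dilate (boxCount a b)) (n + n)
    ≡⟨ cong (λ k → delay₀ k (dilate (boxCount a b)) (n + n)) square ⟩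
  delay₀ (s + s) (dilate (boxCount a b)) (n + n)
    ≡⟨ dilate-delay s (boxCount a b) (n + n) ⟨
  dilate (delay₀ s (boxCount a b)) (n + n)
    ≡⟨ dilate-double (delay₀ s (boxCount a b)) n ⟩
  delay₀ s (boxCount a b) n
    ≡⟨ delay-cong-≤ s (λ {i} i+s≤n → p-boxCount (i≤a i+s≤n) (≤-trans (i≤a i+s≤n) a≤b)) ⟨
  delay₀ s (p ∘ +_) n
    ≡⟨ p-delay n s ⟨
  p (+ n - + s) ∎
  where
  b s : ℕ
  b = x + double m
  s = 2 * m ^ 2
  i≤a : ∀ {i} → i + s ≤ n → i ≤ a
  i≤a {i} i+s≤n = ≤-trans (≤-trans (m≤m+n i s) i+s≤n) n≤a
  a≤b : a ≤ b
  a≤b = ≤-trans (≤-trans (m≤m+n a (double m)) (≤-reflexive a+2m≡x)) (m≤m+n x (double m))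
  double≡ : ∀ m → double m ≡ m + m
  double≡ zero    = refl
  double≡ (suc m) = cong suc (trans (cong suc (double≡ m)) (sym (+-suc m m)))
  expand : ∀ m → (m + m) * (m + m) ≡ 2 * (m * (m * 1)) + 2 * (m * (m * 1))
  expand = solve-∀
  square : double m * double m ≡ s + s
  square = trans (cong (λ k → k * k) (double≡ m)) (expand m)

blockSum-p : ∀ n m → blockSum m n + p (+ n - + (2 * suc m ^ 2)) ≡ p (+ n - + (2 * m ^ 2))
blockSum-p n m = begin
  blockSum m n + p (+ n - + (2 * suc m ^ 2))
    ≡⟨ cong₂ _+_ (blockSum-walkTotal m (m≤m+n n (double (suc m))))
                 (sym (endCount-p (suc m) {n} {n = n} refl ≤-refl)) ⟩
  walkTotal x 0 m (n + n) + endCount x (double (suc m)) (n + n)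
    ≡⟨ walkTotal-origin x m (n + n) ⟩
  endCount x (double m) (n + n)
    ≡⟨ endCount-p m {n + 2} (+-assoc n 2 (double m)) (m≤m+n n 2) ⟩
  p (+ n - + (2 * m ^ 2)) ∎
  where
  -- The box side a is x minus the end point: n for 2m + 2 and n + 2 for 2m, at least n in both
  -- cases.
  x : ℕ
  x = n + double (suc m)

blockSum-formula : ∀ n m → + blockSum m n ≡ + p (+ n - + (2 * m ^ 2)) - + p (+ n - + (2 * suc m ^ 2))
blockSum-formula n m = begin
  + B                ≡⟨ ℤ.+-identityʳ (+ B) ⟨
  + B ℤ.+ 0ℤ         ≡⟨ cong (λ z → + B ℤ.+ z) (ℤ.+-inverseʳ (+ P)) ⟨
  + B ℤ.+ (+ P - + P) ≡⟨ ℤ.+-assoc (+ B) (+ P) (ℤ.- + P) ⟨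
  + (B + P) - + P    ≡⟨ cong (λ k → + k - + P) (blockSum-p n m) ⟩
  + p (+ n - + (2 * m ^ 2)) - + P ∎
  where
  B P : ℕ
  B = blockSum m n
  P = p (+ n - + (2 * suc m ^ 2))

theorem4p5 : (∀ (m : ℕ) →
    blockSeries m ≈ (q^ (2 * m ^ 2) ⊖ q^ (2 * suc m ^ 2)) ⊛ recip pochhammer∞)
    ×
    (∀ (n m : ℕ) →
    + blockSum m n ≡ + p (+ n - + (2 * m ^ 2)) - + p (+ n - + (2 * suc m ^ 2)))
theorem4p5 = series , blockSum-formula
  where
  coefficient : ∀ k n → (q^ k ⊛ recip pochhammer∞) n ≡ + p (+ n - + k)
  coefficient k n = begin
    (q^ k ⊛ recip pochhammer∞) n     ≡⟨ q^-⊛ k (recip pochhammer∞) n ⟩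
    shift k (recip pochhammer∞) n    ≡⟨ delay-cong k recip-pochhammer∞ n ⟩
    shift k (+_ ∘ p ∘ +_) n          ≡⟨ delay-homo +_ k (p ∘ +_) n ⟨
    + delay₀ k (p ∘ +_) n            ≡⟨ cong +_ (p-delay n k) ⟨
    + p (+ n - + k) ∎
  series : ∀ m → blockSeries m ≈ (q^ (2 * m ^ 2) ⊖ q^ (2 * suc m ^ 2)) ⊛ recip pochhammer∞
  series m n = begin
    + blockSum m n
      ≡⟨ blockSum-formula n m ⟩
    + p (+ n - + (2 * m ^ 2)) - + p (+ n - + (2 * suc m ^ 2))
      ≡⟨ cong₂ ℤ._-_ (coefficient (2 * m ^ 2) n) (coefficient (2 * suc m ^ 2) n) ⟨
    (q^ (2 * m ^ 2) ⊛ recip pochhammer∞) n - (q^ (2 * suc m ^ 2) ⊛ recip pochhammer∞) n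
      ≡⟨ ⊛-distribʳ (q^ (2 * m ^ 2)) (q^ (2 * suc m ^ 2)) (recip pochhammer∞) n ⟨
    ((q^ (2 * m ^ 2) ⊖ q^ (2 * suc m ^ 2)) ⊛ recip pochhammer∞) n ∎
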